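{- There is an algorithm that, given a Boolean TDD $D$ over some vtree on a variable set $X$ and a target vtree $(T,b)$ over $X$, constructs a reduced TDD $D_{(T,b)}$ over $(T,b)$ such that $D_{(T,b)}\equiv D$, in time $|D_{(T,b)}|^4\cdot|D|^{\mathcal{O}(1)}$.
   Context: **Vtree.** A variable tree (vtree) over a finite variable set $X$ is a pair $(T,b)$ where $T$ is a rooted full binary tree (every node has 0 or 2 children) and $b$ is a bijection from the leaves of $T$ to $X$. **TDD.** A Tree Decision Diagram over the vtree $(T,b)$ is a tuple $D=((T,b),N,E,\mathrm{out},\lambda)$ where: - $N$ maps each $t\in V(T)$ to a finite nonempty set $N(t)$, with $N(t_1)\cap N(t_2)=\emptyset$ for $t_1\neq t_2$. - For every non-leaf $t\in V(T)$ with children $t_1,t_2$ (in an arbitrary but fixed order), $E$ assigns to each $u\in N(t)$ a set $E(u)\subseteq N(t_1)\times N(t_2)$, and the sets $\{E(u)\mid u\in N(t)\}$ form a partition of $N(t_1)\times N(t_2)$ (for distinct $u$ they are nonempty and disjoint, and together they cover everything). - $\mathrm{out}$ is a set of output labels with $|\mathrm{out}|=|N(r)|$, where $r$ is the root of $T$, and $\lambda:\mathrm{out}\to N(r)$ is a bijection. Semantics: if $t$ is a leaf with $b(t)=x$, each $u\in N(t)$ carries a label $D[u]\in\{x,\neg x,0,1\}$; for distinct $u_1,u_2\in N(t)$ the functions $D[u_1],D[u_2]$ are not simultaneously satisfiable, and (completeness) each of the two values of $x$ satisfies some $D[u]$ with $u\in N(t)$. If $t$ is not a leaf and $u\in N(t)$,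 then $D[u]=\bigvee_{(v,w)\in E(u)}(D[v]\wedge D[w])$. For $\ell\in\mathrm{out}$ put $D[\ell]:=D[\lambda(\ell)]$. The size is $|D|=\sum_{t\in V(T)}|N(t)|$. **Boolean TDD.** A TDD $D$ is Boolean if its output set is $\{0,1\}$; the function computed by $D$ is $D[1]$. Two Boolean TDDs over the same variables are equivalent ($\equiv$) if they compute the same Boolean function. **Factors.** For $f:\{0,1\}^X\to\{0,1\}$ and $Y\subseteq X$, two partial assignments $\alpha_1,\alpha_2:Y\to\{0,1\}$ are equivalent if the restricted functions $f|_{\alpha_1}$ and $f|_{\alpha_2}$ (on $X\setminus Y$) are equal. A factor of $f$ with respect to $Y$ is an equivalence class of this relation. **Reduced.** A Boolean TDD $D$ over $(T,b)$ is reduced if for every $t\in V(T)$ and $u\in N(t)$, the set of satisfying assignments of $D[u]$ is a factor of the function computed by $D$ with respect to $X_t$ (the set of variables labelling leaves of the subtree $T_t$ rooted at $t$), with distinct $u\in N(t)$ giving distinct factors. Convention: if the computed function is constant $c\in\{0,1\}$, the reduced TDD has a single root node, labelled $c$, and the absent output label is read as computing the constant $0$. -}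

module Defs where

open import Data.Bool using (Bool; true; false; _∧_; not; T)
open import Data.Bool.ListAction using (any)
open import Data.Fin using (Fin; toℕ)
open import Data.Fin.Subset using (Subset; _∈_; ⁅_⁆; _∪_; ∁)
open import Data.Fin.Subset.Properties using (_∈?_; x∈⁅x⁆; p⊆p∪q; q⊆p∪q; x∉p⇒x∈∁p)
open import Data.List using (List; allFin; cartesianProduct; filterᵇ; foldr; map)
open import Data.Nat using (ℕ; zero; suc; _+_; NonZero)
open import Data.Product using (∃-syntax; _×_; _,_)
open import Data.Vec using (Vec; []; _∷_; lookup; tabulate)
open import Function.Bundles using (_⇔_)
open import Function.Definitions using (Bijective)
open import Relation.Binary.PropositionalEquality using (_≡_; _≢_; refl)
open import Relation.Nullary using (¬_; yes; no)

------------------------------------------------------------------------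
-- Assignments and factors.  The variable set X is Fin n.

Assignment : ℕ → Set
Assignment n = Vec Bool n

BoolFun : ℕ → Set
BoolFun n = Assignment n → Bool

-- Assignments Y → {0,1}.  The membership proof is irrelevant, so that such an
-- assignment really is a function of the variable alone.
Partial : ∀ {n} → Subset n → Set
Partial {n} Y = (x : Fin n) → .(x ∈ Y) → Bool

total : ∀ {n} {Y : Subset n} → Assignment n → Partial Y
total a x _ = lookup a x

merge : ∀ {n} {Y : Subset n} → Partial Y → Partial (∁ Y) → Assignment n
merge {n} {Y} α β = tabulate value
  where
  value : Fin n → Bool
  value x with x ∈? Y
  ... | yes x∈Y = α x x∈Y
  ... | no  x∉Y = β x (x∉p⇒x∈∁p x∉Y)

restrict : ∀ {n} {Y : Subset n} → BoolFun n → Partial Y → Partial (∁ Y) → Bool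
restrict f α β = f (merge α β)

FactorEquivalent : ∀ {n} → BoolFun n → (Y : Subset n) → Partial Y → Partial Y → Set
FactorEquivalent f Y α₁ α₂ = ∀ β → restrict f α₁ β ≡ restrict f α₂ β

-- The set of assignments given by P is an equivalence class.
IsFactor : ∀ {n} → BoolFun n → (Y : Subset n) → (Partial Y → Set) → Set
IsFactor f Y P = ∃[ α ] ∀ β → P β ⇔ FactorEquivalent f Y α β

------------------------------------------------------------------------
-- Vtrees

data Tree (n : ℕ) : Set where
  leaf : Fin n → Tree n
  node : Tree n → Tree n → Tree n

data Leaf {n : ℕ} : Tree n → Set where
  here  : ∀ {x} → Leaf (leaf x)
  left  : ∀ {t₁ t₂} → Leaf t₁ → Leaf (node t₁ t₂)
  right : ∀ {t₁ t₂} → Leaf t₂ → Leaf (node t₁ t₂)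

label : ∀ {n} {t : Tree n} → Leaf t → Fin n
label (here {x}) = x
label (left p)   = label p
label (right p)  = label p

record VTree (n : ℕ) : Set where
  field
    tree      : Tree n
    bijective : Bijective _≡_ _≡_ (label {t = tree})

open VTree public

vars : ∀ {n} → Tree n → Subset n
vars (leaf x)     = ⁅ x ⁆
vars (node t₁ t₂) = vars t₁ ∪ vars t₂

------------------------------------------------------------------------
-- Tree decision diagrams

data Literal : Set where
  pos neg zero one : Literal

evalLiteral : Literal → Bool → Bool
evalLiteral pos  b = b
evalLiteral neg  b = not b
evalLiteral zero _ = false
evalLiteral one  _ = true

record LeafConditions {k : ℕ} (lit : Fin k → Literal) : Set where
  field
    disjoint : ∀ {u₁ u₂} → u₁ ≢ u₂ →
               ¬ (∃[ b ] T (evalLiteral (lit u₁) b) × T (evalLiteral (lit u₂) b))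
    complete : ∀ b → ∃[ u ] T (evalLiteral (lit u) b)

record IsPartition {k k₁ k₂ : ℕ} (E : Fin k → Fin k₁ × Fin k₂ → Bool) : Set where
  field
    nonempty : ∀ u → ∃[ p ] T (E u p)
    disjoint : ∀ {u₁ u₂} → u₁ ≢ u₂ → ¬ (∃[ p ] T (E u₁ p) × T (E u₂ p))
    cover    : ∀ p → ∃[ u ] T (E u p)

-- Diagram t k carries the data N, E and the leaf labels for all nodes of t;
-- the node set at the root of t is N(t) = Fin k.  Node sets at different
-- positions of t are disjoint because a node is a position together with an
-- index.
data Diagram {n : ℕ} : Tree n → ℕ → Set where
  leaf : ∀ {x k} .{{_ : NonZero k}} (lit : Fin k → Literal) →
         LeafConditions lit → Diagram (leaf x) k
  node : ∀ {t₁ t₂ k₁ k₂ k} .{{_ : NonZero k}} →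
         Diagram t₁ k₁ → Diagram t₂ k₂ →
         (E : Fin k → Fin k₁ × Fin k₂ → Bool) →
         IsPartition E → Diagram (node t₁ t₂) k

pairs : ∀ k₁ k₂ → List (Fin k₁ × Fin k₂)
pairs k₁ k₂ = cartesianProduct (allFin k₁) (allFin k₂)

-- D[u], as a Boolean function of the variables below t
eval : ∀ {n} {t : Tree n} {k} → Diagram t k → Fin k → Partial (vars t) → Bool
eval (leaf {x} lit _) u α = evalLiteral (lit u) (α x (x∈⁅x⁆ x))
eval (node {t₁} {t₂} {k₁} {k₂} d₁ d₂ E _) u α =
  any (λ { (v , w) → E u (v , w) ∧ (eval d₁ v α₁ ∧ eval d₂ w α₂) }) (pairs k₁ k₂)
  where
  α₁ : Partial (vars t₁)
  α₁ x x∈ = α x (p⊆p∪q (vars t₂) x∈)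
  α₂ : Partial (vars t₂)
  α₂ x x∈ = α x (q⊆p∪q (vars t₁) (vars t₂) x∈)

diagramSize : ∀ {n} {t : Tree n} {k} → Diagram t k → ℕ
diagramSize {k = k} (leaf _ _)         = k
diagramSize {k = k} (node d₁ d₂ _ _) = k + (diagramSize d₁ + diagramSize d₂)

record TDD {n : ℕ} (V : VTree n) (Out : Set) : Set where
  field
    width     : ℕ
    diagram   : Diagram (tree V) width
    output    : Out → Fin width
    bijective : Bijective _≡_ _≡_ output

  size : ℕ
  size = diagramSize diagram

  ⟦_⟧ : Out → BoolFun n
  ⟦ ℓ ⟧ a = eval diagram (output ℓ) (total a)

BooleanTDD : ∀ {n} → VTree n → Set
BooleanTDD V = TDD V Bool

computes : ∀ {n} {V : VTree n} → BooleanTDD V → BoolFun n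
computes D = TDD.⟦_⟧ D true

-- A Boolean TDD, or a TDD with a single root node labelled c, in which the
-- absent label computes the constant 0.
data BooleanTDD₁ {n : ℕ} (V : VTree n) : Set where
  full   : BooleanTDD V → BooleanTDD₁ V
  single : (c : Bool) → TDD V (∃[ ℓ ] ℓ ≡ c) → BooleanTDD₁ V

computes₁ : ∀ {n} {V : VTree n} → BooleanTDD₁ V → BoolFun n
computes₁ (full D)         = computes D
computes₁ (single true D)  = TDD.⟦_⟧ D (true , refl)
computes₁ (single false D) = λ _ → false

size₁ : ∀ {n} {V : VTree n} → BooleanTDD₁ V → ℕ
size₁ (full D)     = TDD.size D
size₁ (single _ D) = TDD.size D

_≋_ : ∀ {n} {V W : VTree n} → BooleanTDD₁ V → BooleanTDD₁ W → Set
D ≋ D′ = ∀ a → computes₁ D a ≡ computes₁ D′ a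

ReducedAt : ∀ {n} → BoolFun n → {t : Tree n} {k : ℕ} → Diagram t k → Set
ReducedAt f {t} d =
  (∀ u → IsFactor f (vars t) (λ α → T (eval d u α))) ×
  (∀ {u₁ u₂} → u₁ ≢ u₂ → ¬ (∀ α → eval d u₁ α ≡ eval d u₂ α))

ReducedEverywhere : ∀ {n} → BoolFun n → {t : Tree n} {k : ℕ} → Diagram t k → Set
ReducedEverywhere f d@(leaf _ _)       = ReducedAt f d
ReducedEverywhere f d@(node d₁ d₂ _ _) =
  ReducedAt f d × ReducedEverywhere f d₁ × ReducedEverywhere f d₂

-- A full TDD of a constant function is never reduced: its two root nodes would
-- have to be distinct factors, but there is only one.
Reduced : ∀ {n} {V : VTree n} → BooleanTDD₁ V → Set
Reduced D@(full D′)     = ReducedEverywhere (computes₁ D) (TDD.diagram D′)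
Reduced D@(single _ D′) = ReducedEverywhere (computes₁ D) (TDD.diagram D′)

------------------------------------------------------------------------
-- Algorithms: programs of a first-order call-by-value language whose only data
-- are binary cons cells.  A program is a finite list of mutually recursive
-- unary functions.  Every rule performs one elementary step on pointers in an
-- environment whose length is bounded by the program, so the cost of a run is,
-- up to a constant factor, its time on a pointer machine or unit-cost RAM.

data Value : Set where
  nil  : Value
  _∙_  : Value → Value → Value

infixr 5 _∙_

-- m functions, n variables in scope (de Bruijn indices)
data Term (m n : ℕ) : Set where
  var     : Fin n → Term m n
  nil     : Term m n
  cons    : Term m n → Term m n → Term m n
  let′    : Term m n → Term m (suc n) → Term m n
  caseNil : Term m n → Term m n → Term m (suc (suc n)) → Term m n
  call    : Fin m → Term m n → Term m n

record Program : Set where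
  field
    count : ℕ
    fun   : Fin count → Term count 1
    main  : Term count 1

-- fun / ρ ⊢ e ⇓ v / c : in environment ρ, the term e evaluates to v at cost c.
data _/_⊢_⇓_/_ {m : ℕ} (fun : Fin m → Term m 1) {n : ℕ} (ρ : Vec Value n) :
               Term m n → Value → ℕ → Set where
  var  : ∀ {x} → fun / ρ ⊢ var x ⇓ lookup ρ x / 1
  nil  : fun / ρ ⊢ nil ⇓ nil / 1
  cons : ∀ {e₁ e₂ v₁ v₂ c₁ c₂} →
         fun / ρ ⊢ e₁ ⇓ v₁ / c₁ →
         fun / ρ ⊢ e₂ ⇓ v₂ / c₂ →
         fun / ρ ⊢ cons e₁ e₂ ⇓ v₁ ∙ v₂ / suc (c₁ + c₂)
  let′ : ∀ {e₁ e₂ v₁ v₂ c₁ c₂} →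
         fun / ρ ⊢ e₁ ⇓ v₁ / c₁ →
         fun / (v₁ ∷ ρ) ⊢ e₂ ⇓ v₂ / c₂ →
         fun / ρ ⊢ let′ e₁ e₂ ⇓ v₂ / suc (c₁ + c₂)
  case-nil  : ∀ {e e₁ e₂ v c c₁} →
              fun / ρ ⊢ e ⇓ nil / c →
              fun / ρ ⊢ e₁ ⇓ v / c₁ →
              fun / ρ ⊢ caseNil e e₁ e₂ ⇓ v / suc (c + c₁)
  case-cons : ∀ {e e₁ e₂ v₁ v₂ v c c₂} →
              fun / ρ ⊢ e ⇓ v₁ ∙ v₂ / c →
              fun / (v₁ ∷ v₂ ∷ ρ) ⊢ e₂ ⇓ v / c₂ →
              fun / ρ ⊢ caseNil e e₁ e₂ ⇓ v / suc (c + c₂)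
  call : ∀ {f e v w c₁ c₂} →
         fun / ρ ⊢ e ⇓ v / c₁ →
         fun / (v ∷ []) ⊢ fun f ⇓ w / c₂ →
         fun / ρ ⊢ call f e ⇓ w / suc (c₁ + c₂)

_⟨_⟩⇓_/_ : Program → Value → Value → ℕ → Set
p ⟨ input ⟩⇓ result / cost =
  Program.fun p / (input ∷ []) ⊢ Program.main p ⇓ result / cost

------------------------------------------------------------------------
-- Encodings as values.  Numbers are unary; a set E(u) is the list of its
-- elements in lexicographic order.

encodeℕ : ℕ → Value
encodeℕ zero    = nil
encodeℕ (suc n) = nil ∙ encodeℕ n

encodeFin : ∀ {n} → Fin n → Value
encodeFin i = encodeℕ (toℕ i)

encodeBool : Bool → Value
encodeBool false = nil
encodeBool true  = nil ∙ nil

encodeLiteral : Literal → Value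
encodeLiteral pos  = encodeℕ 0
encodeLiteral neg  = encodeℕ 1
encodeLiteral zero = encodeℕ 2
encodeLiteral one  = encodeℕ 3

encodeList : ∀ {A : Set} → (A → Value) → List A → Value
encodeList enc xs = foldr _∙_ nil (map enc xs)

encodePair : ∀ {k₁ k₂} → Fin k₁ × Fin k₂ → Value
encodePair (v , w) = encodeFin v ∙ encodeFin w

encodeTree : ∀ {n} → Tree n → Value
encodeTree (leaf x)     = nil ∙ encodeFin x
encodeTree (node t₁ t₂) = (nil ∙ nil) ∙ encodeTree t₁ ∙ encodeTree t₂

encodeVTree : ∀ {n} → VTree n → Value
encodeVTree V = encodeTree (tree V)

encodeDiagram : ∀ {n} {t : Tree n} {k} → Diagram t k → Value
encodeDiagram {k = k} (leaf {x} lit _) =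
  nil ∙ encodeFin x ∙ encodeList (λ u → encodeLiteral (lit u)) (allFin k)
encodeDiagram {k = k} (node {k₁ = k₁} {k₂ = k₂} d₁ d₂ E _) =
  (nil ∙ nil) ∙ encodeDiagram d₁ ∙ encodeDiagram d₂ ∙
  encodeList (λ u → encodeList encodePair (filterᵇ (E u) (pairs k₁ k₂))) (allFin k)

-- In the single-root case λ is determined, so only the label c is recorded.
encodeTDD : ∀ {n} {V : VTree n} → BooleanTDD₁ V → Value
encodeTDD (full D) =
  nil ∙ encodeDiagram (TDD.diagram D) ∙
  encodeFin (TDD.output D false) ∙ encodeFin (TDD.output D true)
encodeTDD (single c D) =
  (nil ∙ nil) ∙ encodeDiagram (TDD.diagram D) ∙ encodeBool c

{-# OPTIONS --safe #-}

-- A decision diagram is a deterministic tree automaton: an assignment runs to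
-- exactly one node at every position.  Partial assignments α, β to the same
-- variables are therefore equivalent iff no pair of nodes of D reached by a
-- common completion of α and β is separated by the accepting output, and the
-- set of reachable pairs is computed bottom-up in polynomial time as in the
-- product of D with itself.  The reduced diagram has one representative partial
-- assignment per factor: those of a node of the target tree are chosen among
-- the joins of the representatives of its children, at the price of one
-- equivalence test for each (join, representative) pair.  Hence the time is a
-- polynomial in |D| times Σ k·k₁·k₂ ≤ |D′|³, where k is the number of factors at
-- a node and k₁, k₂ are those of its children.
module Submission where

-- The time may depend on the unknown size of the result only through its fourth power, so the lists
-- kept at a target node must be bounded by the widths of the result: building some larger diagram
-- and minimising it afterwards would not do. Two facts allow the factors to be found directly,
-- bottom-up. Equivalence is a congruence for joins, because sibling subtrees have disjoint
-- variables and each half of a join can be viewed as part of a completion of the other half; so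
-- joins of representatives meet every factor of the parent. And the list of representatives only
-- grows while the joins are scanned, so every join is compared with at most k of them. The two
-- vtrees need not be related: an assignment to a target subtree is merely looked up at the leaves
-- of D. On the machine side, each loop follows the recursion of a list function on typed data, and
-- its run is specified as producing the encoding of that function's value.

open import Defs
open import Algebra.Properties.CommutativeSemigroup using (interchange)
open import Data.Bool using (Bool; true; false; T; if_then_else_; _∧_; _∨_)
open import Data.Bool.ListAction using (any; all)
import Data.Bool.Properties as Bool
open import Data.Empty using (⊥; ⊥-elim)
open import Data.Fin using (Fin; zero; suc; toℕ; _≟_; combine)
open import Data.Fin.Properties using (injective⇒≤; combine-injective; suc-injective)
open import Data.Fin.Subset using (Subset; ∣_∣; inside; outside; _∪_) renaming (_∈_ to _∈ₛ_; _∉_ to _∉ₛ_; ⊤ to ⊤ₛ)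
open import Data.Fin.Subset.Properties using (_∈?_; x∈⁅x⁆; x∈⁅y⁆⇒x≡y; p⊆p∪q; q⊆p∪q; x∈p∪q⁻; x∉p⇒x∈∁p; ∣⁅x⁆∣≡1; ∣p∣≤n; ∣⊤∣≡n; p⊆q⇒∣p∣≤∣q∣)
open import Data.List using (List; []; _∷_; length; allFin; tabulate; cartesianProduct; lookup; map; _++_; filterᵇ; foldr)
open import Data.List.Membership.Propositional using (_∈_; find; lose)
open import Data.List.Membership.Propositional.Properties using (∈-cartesianProduct⁺; ∈-cartesianProduct⁻; ∈-allFin; ∈-lookup; ∈-filter⁺; ∈-filter⁻)
open import Data.List.Properties using (length-tabulate; length-filter; length-map; length-++; map-tabulate; tabulate-cong)
open import Data.List.Relation.Unary.All as All using ([]; _∷_)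
open import Data.List.Relation.Unary.All.Properties using (all⁺; all⁻)
open import Data.List.Relation.Unary.AllPairs using (AllPairs; []; _∷_)
open import Data.List.Relation.Unary.Any as Any using (Any; here; there)
open import Data.List.Relation.Unary.Any.Properties using (any⁺; any⁻; lookup-index)
open import Data.Nat using (ℕ; zero; suc; _+_; _*_; _^_; _≤_; _≤ᵇ_; s≤s; z≤n; NonZero; >-nonZero)
open import Data.Nat.Properties hiding (_≟_; suc-injective)
open import Data.Nat.Solver using (module +-*-Solver)
open import Data.Product using (Σ; ∃-syntax; _×_; _,_; proj₁; proj₂)
open import Data.Sum using (inj₁; inj₂)
open import Data.Unit using (⊤; tt)
open import Data.Vec as Vec using (Vec; []; _∷_)
open import Data.Vec.Properties using (lookup∘tabulate)
open import Function using (_∋_; _∘_; id; _⇔_; mk⇔; Equivalence)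
open import Function.Definitions using (Bijective)
open import Relation.Binary.PropositionalEquality
open import Relation.Nullary using (¬_; Dec; yes; no; does; contradiction)
open import Relation.Nullary.Decidable using (T?)
open +-*-Solver using (solve; _:+_; _:*_; _:^_; _:=_; con)

-- Weakest preconditions

branch : Value → Set → (Value → Value → Set) → Set
branch nil     P Q = P
branch (v ∙ w) P Q = Q v w

-- As a record this keeps `k` and `s` visible to unification; in a bare inequality the sum would be
-- normalised and its two parts lost.
record Within (k s bound : ℕ) : Set where
  constructor within
  field
    total-≤ : k + s ≤ bound

module Machine {m : ℕ} (fun : Fin m → Term m 1) where

  record Runs (f : Fin m) (v w : Value) (bound : ℕ) : Set where
    constructor runs
    field
      {cost}  : ℕ
      run     : fun / v ∷ [] ⊢ fun f ⇓ w / cost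
      bounded : cost ≤ bound

  -- k counts the elementary steps and s the cost of the calls.  They are kept
  -- apart because k is a numeral for loop-free code, so that bounds on it can
  -- be decided.
  wp : ∀ {n} → Term m n → Vec Value n → ℕ → ℕ → (Value → ℕ → ℕ → Set) → Set
  wp (var x) ρ k s Q = Q (Vec.lookup ρ x) (suc k) s
  wp nil ρ k s Q = Q nil (suc k) s
  wp (cons e₁ e₂) ρ k s Q =
    wp e₁ ρ (suc k) s λ v₁ k s → wp e₂ ρ k s λ v₂ k s → Q (v₁ ∙ v₂) k s
  wp (let′ e₁ e₂) ρ k s Q =
    wp e₁ ρ (suc k) s λ v k s → wp e₂ (v ∷ ρ) k s Q
  wp (caseNil e e₁ e₂) ρ k s Q =
    wp e ρ (suc k) s λ v k s →
      branch v (wp e₁ ρ k s Q) λ v₁ v₂ → wp e₂ (v₁ ∷ v₂ ∷ ρ) k s Q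
  wp (call f e) ρ k s Q =
    wp e ρ (suc k) s λ v k s →
      ∃[ w ] ∃[ bound ] Runs f v w bound × Q w k (s + bound)

  infixr 4 _▸_
  _▸_ : ∀ {f v w bound} {Q : Value → ℕ → Set} → Runs f v w bound → Q w bound →
        ∃[ w ] ∃[ bound ] Runs f v w bound × Q w bound
  r ▸ q = _ , _ , r , q

  private
    Outcome : ∀ {n} → Term m n → Vec Value n → ℕ → (Value → ℕ → ℕ → Set) → Set
    Outcome e ρ start Q =
      ∃[ v ] ∃[ c ] ∃[ k ] ∃[ s ]
        (fun / ρ ⊢ e ⇓ v / c) × start + c ≤ k + s × Q v k s

    one-step : ∀ k s → k + s + 1 ≤ suc k + s
    one-step k s = ≤-reflexive (+-comm (k + s) 1)

    two-parts : ∀ a {b c} c₁ c₂ → suc a + c₁ ≤ b → b + c₂ ≤ c → a + suc (c₁ + c₂) ≤ c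
    two-parts a {b} {c} c₁ c₂ p q = begin
      a + suc (c₁ + c₂) ≡⟨ +-suc a (c₁ + c₂) ⟩
      suc (a + (c₁ + c₂)) ≡⟨ cong suc (+-assoc a c₁ c₂) ⟨
      suc a + c₁ + c₂     ≤⟨ +-monoˡ-≤ c₂ p ⟩
      b + c₂              ≤⟨ q ⟩
      c                   ∎
      where open ≤-Reasoning

  -- Soundness of `wp`. The accounting is an inequality because a call enters the precondition only
  -- through an upper bound on its cost.
  wp-outcome : ∀ {n} (e : Term m n) ρ k s {Q} → wp e ρ k s Q → Outcome e ρ (k + s) Q
  wp-outcome (var x) ρ k s q = _ , _ , _ , _ , var , one-step k s , q
  wp-outcome nil     ρ k s q = _ , _ , _ , _ , nil , one-step k s , q
  wp-outcome (cons e₁ e₂) ρ k s q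
    with _ , c₁ , k₁ , s₁ , d₁ , b₁ , q₁ ← wp-outcome e₁ ρ (suc k) s q
    with _ , c₂ , k₂ , s₂ , d₂ , b₂ , q₂ ← wp-outcome e₂ ρ k₁ s₁ q₁
    = _ , _ , _ , _ , cons d₁ d₂ , two-parts (k + s) c₁ c₂ b₁ b₂ , q₂
  wp-outcome (let′ e₁ e₂) ρ k s q
    with v , c₁ , k₁ , s₁ , d₁ , b₁ , q₁ ← wp-outcome e₁ ρ (suc k) s q
    with _ , c₂ , k₂ , s₂ , d₂ , b₂ , q₂ ← wp-outcome e₂ (v ∷ ρ) k₁ s₁ q₁
    = _ , _ , _ , _ , let′ d₁ d₂ , two-parts (k + s) c₁ c₂ b₁ b₂ , q₂
  wp-outcome (caseNil e e₁ e₂) ρ k s q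
    with wp-outcome e ρ (suc k) s q
  ... | nil , c₁ , k₁ , s₁ , d₁ , b₁ , q₁
    with _ , c₂ , k₂ , s₂ , d₂ , b₂ , q₂ ← wp-outcome e₁ ρ k₁ s₁ q₁
    = _ , _ , _ , _ , case-nil d₁ d₂ , two-parts (k + s) c₁ c₂ b₁ b₂ , q₂
  ... | v₁ ∙ v₂ , c₁ , k₁ , s₁ , d₁ , b₁ , q₁
    with _ , c₂ , k₂ , s₂ , d₂ , b₂ , q₂ ← wp-outcome e₂ (v₁ ∷ v₂ ∷ ρ) k₁ s₁ q₁
    = _ , _ , _ , _ , case-cons d₁ d₂ , two-parts (k + s) c₁ c₂ b₁ b₂ , q₂
  wp-outcome (call f e) ρ k s q
    with _ , c₁ , k₁ , s₁ , d₁ , b₁ , w , bound , runs {c₂} d₂ b₂ , q₁ ← wp-outcome e ρ (suc k) s q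
    = _ , _ , _ , _ , call d₁ d₂ ,
      two-parts (k + s) c₁ c₂ b₁
        (≤-trans (+-monoʳ-≤ (k₁ + s₁) b₂) (≤-reflexive (+-assoc k₁ s₁ bound))) , q₁

  Returns : Value → ℕ → Value → ℕ → ℕ → Set
  Returns w bound w′ k s = w′ ≡ w × Within k s bound

  wp-run : ∀ (e : Term m 1) {v w bound} → wp e (v ∷ []) 0 0 (Returns w bound) →
           ∃[ c ] (fun / v ∷ [] ⊢ e ⇓ w / c) × c ≤ bound
  wp-run e p with _ , c , _ , _ , d , b , refl , within b′ ← wp-outcome e _ 0 0 p
    = c , d , ≤-trans b b′

  by-wp : ∀ {f v w bound} → wp (fun f) (v ∷ []) 0 0 (Returns w bound) → Runs f v w bound
  by-wp {f} p = runs (proj₁ (proj₂ (wp-run (fun f) p))) (proj₂ (proj₂ (wp-run (fun f) p)))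

  weaken : ∀ {f v w b b′} → b ≤ b′ → Runs f v w b → Runs f v w b′
  weaken p (runs d q) = runs d (≤-trans q p)

  result : ∀ {f v w w′ b} → w ≡ w′ → Runs f v w b → Runs f v w′ b
  result refl r = r

abstract
  -- An upper bound for the number of elementary steps in each loop-free body.
  K : ℕ
  K = 100

  -- The argument `p` is found by evaluation: on straight-line code `k` is a numeral, so
  -- `T (k ≤ᵇ 100)` reduces to the unit type. `K` stays opaque outside, so bounds remain symbolic in
  -- it.
  ticks : ∀ {k s b} {p : T (k ≤ᵇ 100)} → s ≤ b → Within k s (K + b)
  ticks {k} {p = p} s≤b = within (+-mono-≤ (≤ᵇ⇒≤ k 100 p) s≤b)

  ticks₀ : ∀ {k} {p : T (k ≤ᵇ 100)} → Within k 0 K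
  ticks₀ {k} {p} = within (≤-trans (≤-reflexive (+-identityʳ k)) (≤ᵇ⇒≤ k 100 p))

pattern v0 = var zero
pattern v1 = var (suc zero)
pattern v2 = var (suc (suc zero))
pattern v3 = var (suc (suc (suc zero)))
pattern v4 = var (suc (suc (suc (suc zero))))
pattern v5 = var (suc (suc (suc (suc (suc zero)))))
pattern v6 = var (suc (suc (suc (suc (suc (suc zero))))))
pattern v7 = var (suc (suc (suc (suc (suc (suc (suc zero)))))))
pattern v8 = var (suc (suc (suc (suc (suc (suc (suc (suc zero))))))))
pattern v9 = var (suc (suc (suc (suc (suc (suc (suc (suc (suc zero)))))))))
pattern v10 = var (suc (suc (suc (suc (suc (suc (suc (suc (suc (suc zero))))))))))
pattern v11 = var (suc (suc (suc (suc (suc (suc (suc (suc (suc (suc (suc zero)))))))))))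
pattern v12 = var (suc (suc (suc (suc (suc (suc (suc (suc (suc (suc (suc (suc zero))))))))))))
pattern v13 = var (suc (suc (suc (suc (suc (suc (suc (suc (suc (suc (suc (suc (suc zero)))))))))))))
pattern v14 = var (suc (suc (suc (suc (suc (suc (suc (suc (suc (suc (suc (suc (suc (suc zero))))))))))))))

-- Only applied to terms whose value is a cons cell.
uncons : ∀ {m n} → Term m n → Term m (2 + n) → Term m n
uncons e = caseNil e nil

yes′ : ∀ {m n} → Term m n
yes′ = cons nil nil

-- Both receive a context; folds map  ctx ∙ acc ∙ list  and their steps
-- ctx ∙ x ∙ acc  to the new accumulator.
stepCode : ∀ {m} → Term m 5 → Term m 1
stepCode body = uncons v0 (uncons v1 body)

foldCode : ∀ {m} → Fin m → Fin m → Term m 1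
foldCode self step = uncons v0 (uncons v1 (caseNil v1 v0
  (call step (cons v4 (cons v0 (call self (cons v4 (cons v2 v1))))))))

-- Polynomial bounds

infixl 6 _⊕_
infixl 7 _⊗_

-- Bounds are kept as syntax so that one exponent, independent of the instance, can be read off the
-- whole running time by recursion.
data Poly : Set where
  const   : ℕ → Poly
  𝕏       : Poly
  _⊕_ _⊗_ : Poly → Poly → Poly

infix 8 _at_
_at_ : Poly → ℕ → ℕ
const k at m = k
𝕏       at m = m
(p ⊕ q) at m = p at m + q at m
(p ⊗ q) at m = p at m * q at m

n≤2^n : ∀ n → n ≤ 2 ^ n
n≤2^n zero    = z≤n
n≤2^n (suc n) = begin
  suc n         ≤⟨ +-mono-≤ (m^n>0 2 n) (n≤2^n n) ⟩
  2 ^ n + 2 ^ n ≡⟨ cong (2 ^ n +_) (+-identityʳ (2 ^ n)) ⟨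
  2 ^ suc n     ∎
  where open ≤-Reasoning

-- With base at least 2, a constant `k` is absorbed by the exponent `k`, and the factor 2 of a sum
-- by one more unit of the exponent. The size of a Boolean TDD is such a base, since its two outputs
-- need two root nodes.
poly-≤-power : ∀ p → ∃[ c ] ∀ {m} → 2 ≤ m → p at m ≤ m ^ c
poly-≤-power (const k) = k , λ 2≤m → ≤-trans (n≤2^n k) (^-monoˡ-≤ k 2≤m)
poly-≤-power 𝕏 = 1 , λ {m} _ → ≤-reflexive (sym (*-identityʳ m))
poly-≤-power (p ⊕ q) with poly-≤-power p | poly-≤-power q
... | i , p≤ | j , q≤ = suc (i + j) , bound
  where
  open ≤-Reasoning
  bound : ∀ {m} → 2 ≤ m → p at m + q at m ≤ m ^ suc (i + j)
  bound {m@(suc _)} 2≤m = begin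
    p at m + q at m             ≤⟨ +-mono-≤ (p≤ 2≤m) (q≤ 2≤m) ⟩
    m ^ i + m ^ j               ≤⟨ +-mono-≤ (^-monoʳ-≤ m (m≤m+n i j)) (^-monoʳ-≤ m (m≤n+m j i)) ⟩
    m ^ (i + j) + m ^ (i + j)   ≡⟨ cong (m ^ (i + j) +_) (+-identityʳ (m ^ (i + j))) ⟨
    2 * m ^ (i + j)             ≤⟨ *-monoˡ-≤ (m ^ (i + j)) 2≤m ⟩
    m ^ suc (i + j)             ∎
poly-≤-power (p ⊗ q) with poly-≤-power p | poly-≤-power q
... | i , p≤ | j , q≤ = i + j , λ {m} 2≤m →
  ≤-trans (*-mono-≤ (p≤ 2≤m) (q≤ 2≤m)) (≤-reflexive (sym (^-distribˡ-+-* m i j)))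

-- The program

Name : Set
Name = Fin 29

pattern equalF = zero
pattern lookF = suc equalF
pattern literalStepF = suc lookF
pattern literalIndexF = suc literalStepF
pattern leafPairF = suc literalIndexF
pattern elemStepF = suc leafPairF
pattern elemF = suc elemStepF
pattern indexStepF = suc elemF
pattern indexF = suc indexStepF
pattern pairStepF = suc indexF
pattern pairF = suc pairStepF
pattern crossStepF = suc pairF
pattern crossF = suc crossStepF
pattern insertStepF = suc crossF
pattern insertF = suc insertStepF
pattern reachF = suc insertF
pattern agreeStepF = suc reachF
pattern agreeF = suc agreeStepF
pattern equivalentF = suc agreeF
pattern knownStepF = suc equivalentF
pattern knownF = suc knownStepF
pattern classStepF = suc knownF
pattern classesF = suc classStepF
pattern numberF = suc classesF
pattern rowStepF = suc numberF
pattern rowF = suc rowStepF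
pattern rowsStepF = suc rowF
pattern rowsF = suc rowsStepF
pattern buildF = suc rowsF

code : Name → Term 29 1
code equalF =
  uncons v0 (caseNil v0
    (caseNil v1 yes′ nil)
    (caseNil v3 nil
      (caseNil (call equalF (cons v2 v0)) nil (call equalF (cons v5 v3)))))
code lookF =
  uncons v0 (uncons v1 (uncons v2 (uncons v1 (caseNil v2
    (caseNil (call equalF (cons v0 v4)) v5 v3)
    (call lookF (cons v2 (cons v6 (call lookF (cons v3 (cons v6 v7))))))))))
code literalStepF =
  stepCode (caseNil v0
    (caseNil v2 (cons nil v1) nil)
    (caseNil v1
      (caseNil v4 nil (cons nil v5))
      (caseNil v1 (cons nil v5) nil)))
code literalIndexF = foldCode literalIndexF literalStepF
code leafPairF =
  uncons v0 (uncons v1 (uncons v1 (uncons v1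
    (cons (call literalIndexF (cons (call lookF (cons v4 (cons v0 v6))) (cons nil v1)))
          (call literalIndexF (cons (call lookF (cons v2 (cons v0 v6))) (cons nil v1)))))))
code elemStepF = stepCode (caseNil (call equalF (cons v2 v0)) v1 yes′)
code elemF = foldCode elemF elemStepF
code indexStepF = stepCode (caseNil (call elemF (cons v2 (cons nil v0))) (cons nil v1) nil)
code indexF = foldCode indexF indexStepF
code pairStepF = stepCode (cons (cons v2 v0) v1)
code pairF = foldCode pairF pairStepF
-- The accumulator is the start value of the inner fold, which makes a separate append unnecessary.
code crossStepF = stepCode (call pairF (cons v0 (cons v1 v2)))
code crossF = foldCode crossF crossStepF
code insertStepF =
  stepCode (uncons v0 (uncons v0 (uncons v3
    (let′ (cons (call indexF (cons (cons v2 v0) (cons nil v8)))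
                (call indexF (cons (cons v3 v1) (cons nil v8))))
      (caseNil (call elemF (cons v0 (cons nil v8))) (cons v0 v8) v10)))))
code insertF = foldCode insertF insertStepF
code reachF =
  uncons v0 (uncons v1 (uncons v1 (uncons v1 (caseNil v2
    (cons (call leafPairF (cons nil (cons v6 (cons v4 v3))))
      (cons (call leafPairF (cons yes′ (cons v6 (cons v4 v3)))) nil))
    (uncons v3
      (call insertF (cons v1 (cons nil
        (call crossF (cons (call reachF (cons v10 (cons v8 v0))) (cons nil
          (call reachF (cons v10 (cons v8 v4))))))))))))))
code agreeStepF =
  stepCode (uncons v0
    (caseNil (call equalF (cons (call equalF (cons v0 v4)) (call equalF (cons v1 v4))))
      nil v5))
code agreeF = foldCode agreeF agreeStepF
code equivalentF =
  uncons v0 (uncons v0 (uncons v3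
    (call agreeF (cons v3 (cons yes′ (call reachF (cons v0 (cons v1 v2))))))))
code knownStepF =
  stepCode (uncons v2 (caseNil (call equivalentF (cons v0 (cons v1 v2))) v3 yes′))
code knownF = foldCode knownF knownStepF
code classStepF =
  stepCode (uncons v0 (uncons v0 (uncons v3
    (let′ (cons yes′ (cons v3 v1))
      (caseNil (call knownF (cons (cons v9 v0) (cons nil v8))) (cons v0 v8) v10)))))
code classesF = foldCode classesF classStepF
code numberF =
  uncons v0 (caseNil v1 nil
    (cons (cons v2 v0) (call numberF (cons (cons nil v2) v1))))
code rowStepF =
  stepCode (uncons v0 (uncons v0 (uncons v3 (uncons v8
    (caseNil (call equivalentF (cons v0 (cons v1 (cons yes′ (cons v5 v3)))))
      v9 (cons (cons v6 v4) v11))))))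
code rowF = foldCode rowF rowStepF
code rowsStepF =
  stepCode (uncons v0 (uncons v4
    (cons (call rowF (cons (cons v0 v3) (cons nil v1))) v5)))
code rowsF = foldCode rowsF rowsStepF
-- The result is the list of numbered representatives together with the diagram. Edges are pairs of
-- indices, so each representative carries its numeral along.
code buildF =
  uncons v0 (uncons v1 (caseNil v0
    (caseNil (call equivalentF (cons v2 (cons (bit nil v1) (bit yes′ v1))))
      (cons (cons (cons nil (bit nil v1)) (cons (cons yes′ (bit yes′ v1)) nil))
            -- Literals are numerals: `neg` is 1, which is the same value as `yes′`, and `pos` is 0.
            -- In the other branch `one` is 3.
            (cons nil (cons v1 (cons yes′ (cons nil nil)))))
      (cons (cons (cons nil (bit nil v3)) nil)
            (cons nil (cons v3 (cons (cons nil (cons nil yes′)) nil)))))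
    (uncons v3
      (let′ (call buildF (cons v6 v0))
        (let′ (call buildF (cons v7 v2))
          (uncons v1 (uncons v2
            (let′ (call crossF (cons v0 (cons nil v2)))
              (let′ (call numberF (cons nil (call classesF (cons v13 (cons nil v0)))))
                (cons v0 (cons yes′ (cons v5 (cons v3
                  (call rowsF (cons (cons v14 v1) (cons nil v0))))))))))))))))
  where
  bit : ∀ {n} → Term 29 n → Term 29 n → Term 29 n
  bit b x = cons nil (cons x b)

mainCode : Term 29 1
mainCode =
  uncons v0 (uncons v0 (uncons v1 (uncons v1
    (let′ (call buildF (cons (cons v2 v1) v7))
      (uncons v0 (uncons v0 (uncons v0
        -- The function is evaluated at the first representative by pairing it with itself: it
        -- assigns every variable, so all reachable pairs consist of its run, and the first pair
        -- suffices.
        (let′ (uncons (call reachF (cons v1 (cons v1 v9)))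
                (uncons v0 (call equalF (cons v0 v12))))
          (caseNil v4
            (cons yes′ (cons v6 v0))
            (cons nil (cons v8
              (caseNil v2 (cons nil yes′) (cons yes′ nil)))))))))))))

algorithm : Program
algorithm = record { count = 29 ; fun = code ; main = mainCode }

open Machine code

-- Representatives, distinct pairs and positions in lists

does⁺ : ∀ {A : Set} (a? : Dec A) → A → T (does a?)
does⁺ (yes _) _ = tt
does⁺ (no ¬a) a = ¬a a

does⁻ : ∀ {A : Set} (a? : Dec A) → T (does a?) → A
does⁻ (yes a) _ = a

module _ {A B : Set} (_~_ : B → B → Bool) (f : A → B) where

  -- Used twice: with `_==_` it removes duplicates among reachable pairs, with factor equivalence it
  -- chooses one assignment per factor. It works from the back, like the folds of the program.
  representatives : List A → List B
  representatives []       = []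
  representatives (x ∷ xs) =
    if any (f x ~_) (representatives xs) then representatives xs
    else f x ∷ representatives xs

  representatives-⊆ : ∀ {y} xs → y ∈ representatives xs → ∃[ x ] x ∈ xs × y ≡ f x
  representatives-⊆ (x ∷ xs) y∈ with any (f x ~_) (representatives xs)
  representatives-⊆ (x ∷ xs) y∈ | true =
    let x′ , x′∈ , eq = representatives-⊆ xs y∈ in x′ , there x′∈ , eq
  representatives-⊆ (x ∷ xs) (here refl) | false = x , here refl , refl
  representatives-⊆ (x ∷ xs) (there y∈) | false =
    let x′ , x′∈ , eq = representatives-⊆ xs y∈ in x′ , there x′∈ , eq

  representatives-cover : (∀ y → T (y ~ y)) →
    ∀ {x} xs → x ∈ xs → Any (λ y → T (f x ~ y)) (representatives xs)
  representatives-cover ~-refl (x ∷ xs) x∈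
    with any (f x ~_) (representatives xs) in eq
  representatives-cover ~-refl (x ∷ xs) (here refl) | true =
    any⁻ (f x ~_) (representatives xs) (subst T (sym eq) tt)
  representatives-cover ~-refl (x ∷ xs) (there x∈) | true =
    representatives-cover ~-refl xs x∈
  representatives-cover ~-refl (x ∷ xs) (here refl) | false = here (~-refl (f x))
  representatives-cover ~-refl (x ∷ xs) (there x∈) | false =
    there (representatives-cover ~-refl xs x∈)

  representatives-distinct : ∀ xs → AllPairs (λ y z → ¬ T (y ~ z)) (representatives xs)
  representatives-distinct [] = []
  representatives-distinct (x ∷ xs) with any (f x ~_) (representatives xs) in eq
  ... | true  = representatives-distinct xs
  ... | false =
    All.tabulate (λ z∈ fx~z → subst T eq (any⁺ (f x ~_) (lose z∈ fx~z))) ∷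
    representatives-distinct xs

  -- Bounds every intermediate list by the final one, so that a scan costs the number of factors and
  -- not the number of candidates.
  length-representatives-∷ : ∀ x xs →
    length (representatives xs) ≤ length (representatives (x ∷ xs))
  length-representatives-∷ x xs with any (f x ~_) (representatives xs)
  ... | true  = ≤-refl
  ... | false = n≤1+n _

lookup-distinct : ∀ {A : Set} {R : A → A → Set} → (∀ {x y} → R x y → R y x) →
  ∀ {xs} → AllPairs R xs → ∀ {i j} → i ≢ j → R (lookup xs i) (lookup xs j)
lookup-distinct R-sym (r ∷ rs) {zero}  {zero}  i≢j = contradiction refl i≢j
lookup-distinct R-sym (r ∷ rs) {zero}  {suc j} i≢j = All.lookup r (∈-lookup j)
lookup-distinct R-sym (r ∷ rs) {suc i} {zero}  i≢j = R-sym (All.lookup r (∈-lookup i))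
lookup-distinct R-sym (r ∷ rs) {suc i} {suc j} i≢j =
  lookup-distinct R-sym rs (i≢j ∘ cong suc)

infix 4 _==_
_==_ : ∀ {k l} → Fin k × Fin l → Fin k × Fin l → Bool
(u , v) == (u′ , v′) = does (u ≟ u′) ∧ does (v ≟ v′)

==-refl : ∀ {k l} (p : Fin k × Fin l) → T (p == p)
==-refl (u , v) = Equivalence.from Bool.T-∧ (does⁺ (u ≟ u) refl , does⁺ (v ≟ v) refl)

==⇒≡ : ∀ {k l} (p q : Fin k × Fin l) → T (p == q) → p ≡ q
==⇒≡ (u , v) (u′ , v′) t with Equivalence.to (Bool.T-∧ {does (u ≟ u′)}) t
... | a , b = cong₂ _,_ (does⁻ (u ≟ u′) a) (does⁻ (v ≟ v′) b)

distinct-pairs-≤ : ∀ {k l} {ps : List (Fin k × Fin l)} →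
  AllPairs (λ p q → ¬ T (p == q)) ps → length ps ≤ k * l
distinct-pairs-≤ {k} {l} {ps} distinct = injective⇒≤ {f = index} injective
  where
  index : Fin (length ps) → Fin (k * l)
  index i = combine (proj₁ (lookup ps i)) (proj₂ (lookup ps i))
  ==-sym : ∀ {p q : Fin k × Fin l} → ¬ T (p == q) → ¬ T (q == p)
  ==-sym {p} {q} ¬p==q q==p = ¬p==q (subst (λ r → T (p == r)) (sym (==⇒≡ q p q==p)) (==-refl p))
  injective : ∀ {i j} → index i ≡ index j → i ≡ j
  injective {i} {j} eq with i ≟ j
  ... | yes i≡j = i≡j
  ... | no  i≢j with combine-injective _ _ _ _ eq
  ...   | eq₁ , eq₂ = ⊥-elim (lookup-distinct {R = λ p q → ¬ T (p == q)} (λ {p} {q} → ==-sym {p} {q}) distinct i≢j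
    (subst (λ q → T (lookup ps i == q)) (cong₂ _,_ eq₁ eq₂) (==-refl (lookup ps i))))

position : ∀ {A : Set} → (A → Bool) → List A → ℕ
position f []       = 0
position f (x ∷ xs) = if f x then 0 else suc (position f xs)

-- The program sees a transition only as a list of literals or of edge sets and recovers the target
-- node as the position of the first hit; determinism makes that hit the only one.
position-tabulate : ∀ {A : Set} {k} (g : Fin k → A) (f : A → Bool) u → T (f (g u)) →
  (∀ v → T (f (g v)) → v ≡ u) → position f (tabulate g) ≡ toℕ u
position-tabulate g f zero fu unique with f (g zero)
... | true = refl
position-tabulate g f (suc u) fu unique with f (g zero) in eq
... | true  = contradiction (unique zero (subst T (sym eq) tt)) λ ()
... | false = cong suc (position-tabulate (g ∘ suc) f u fu (λ v t → suc-injective (unique (suc v) t)))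

-- Decision diagrams as tree automata

sat : ∀ {k} {lit : Fin k → Literal} → LeafConditions lit → Bool → Fin k
sat cond b = proj₁ (LeafConditions.complete cond b)

sat-unique : ∀ {k} {lit : Fin k → Literal} (cond : LeafConditions lit) b {u} →
  T (evalLiteral (lit u) b) → u ≡ sat cond b
sat-unique cond b {u} t with u ≟ sat cond b
... | yes eq  = eq
... | no  neq = ⊥-elim (LeafConditions.disjoint cond neq (b , t , proj₂ (LeafConditions.complete cond b)))

step : ∀ {k k₁ k₂} {E : Fin k → Fin k₁ × Fin k₂ → Bool} → IsPartition E →
  Fin k₁ × Fin k₂ → Fin k
step part p = proj₁ (IsPartition.cover part p)

step-unique : ∀ {k k₁ k₂} {E : Fin k → Fin k₁ × Fin k₂ → Bool} (part : IsPartition E) p {u} →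
  T (E u p) → u ≡ step part p
step-unique part p {u} t with u ≟ step part p
... | yes eq  = eq
... | no  neq = ⊥-elim (IsPartition.disjoint part neq (p , t , proj₂ (IsPartition.cover part p)))

run : ∀ {n k} {t : Tree n} → Diagram t k → (Fin n → Bool) → Fin k
run (leaf {x} lit cond) γ = sat cond (γ x)
run (node d₁ d₂ E part) γ = step part (run d₁ γ , run d₂ γ)

run-cong : ∀ {n k} {t : Tree n} (d : Diagram t k) {γ γ′} →
  (∀ {x} → x ∈ₛ vars t → γ x ≡ γ′ x) → run d γ ≡ run d γ′
run-cong (leaf {x} lit cond) eq = cong (sat cond) (eq (x∈⁅x⁆ x))
run-cong (node {t₁} {t₂} d₁ d₂ E part) eq = cong (step part)
  (cong₂ _,_ (run-cong d₁ (eq ∘ p⊆p∪q (vars t₂))) (run-cong d₂ (eq ∘ q⊆p∪q (vars t₁) (vars t₂))))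

any-pairs⁺ : ∀ k l (f : Fin k × Fin l → Bool) v w → T (f (v , w)) → T (any f (pairs k l))
any-pairs⁺ k l f v w t = any⁺ f (lose (∈-cartesianProduct⁺ (∈-allFin v) (∈-allFin w)) t)

any-pairs⁻ : ∀ k l (f : Fin k × Fin l → Bool) → T (any f (pairs k l)) →
  ∃[ v ] ∃[ w ] T (f (v , w))
any-pairs⁻ k l f t with find (any⁻ f (pairs k l) t)
... | (v , w) , _ , t′ = v , w , t′

-- Leaf labels and edge sets each select exactly one node, so the disjunction defining D[u] has a
-- true disjunct only on the path of the run.
eval-run : ∀ {n k} {t : Tree n} (d : Diagram t k) u a →
  T (eval d u (total a)) ⇔ u ≡ run d (Vec.lookup a)
eval-run (leaf {x} lit cond) u a = mk⇔ (sat-unique cond _)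
  λ { refl → proj₂ (LeafConditions.complete cond (Vec.lookup a x)) }
eval-run {k = k} (node {k₁ = k₁} {k₂} d₁ d₂ E part) u a = mk⇔ to from
  where
  to : T (eval (node d₁ d₂ E part) u (total a)) → u ≡ run (node d₁ d₂ E part) (Vec.lookup a)
  to t with any-pairs⁻ k₁ k₂ _ t
  ... | v , w , t′
    with tE , t″ ← Equivalence.to (Bool.T-∧ {E u (v , w)}) t′
    with t₁ , t₂ ← Equivalence.to (Bool.T-∧ {eval d₁ v (total a)}) t″
    with refl ← Equivalence.to (eval-run d₁ v a) t₁
    with refl ← Equivalence.to (eval-run d₂ w a) t₂
    = step-unique part _ tE
  from : u ≡ run (node d₁ d₂ E part) (Vec.lookup a) → T (eval (node d₁ d₂ E part) u (total a))
  from refl = any-pairs⁺ k₁ k₂ _ _ _ (Equivalence.from Bool.T-∧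
    (proj₂ (IsPartition.cover part _) , Equivalence.from Bool.T-∧
      (Equivalence.from (eval-run d₁ _ a) refl , Equivalence.from (eval-run d₂ _ a) refl)))

accepts : ∀ {n k} {t : Tree n} → Diagram t k → Fin k → (Fin n → Bool) → Bool
accepts d o γ = does (run d γ ≟ o)

-- Partial assignments as first-order data in the shape of the subtree: unlike the functions
-- `Partial`, they can be encoded, and joining two of them is one constructor.
data Asg {n : ℕ} : Tree n → Set where
  leaf : ∀ {x} → Bool → Asg (leaf x)
  node : ∀ {t₁ t₂} → Asg t₁ → Asg t₂ → Asg (node t₁ t₂)

assign : ∀ {n} {t : Tree n} → Asg t → Fin n → Bool → Bool
assign (leaf {y} b) x c = if does (y ≟ x) then b else c
assign (node α β)   x c = assign α x (assign β x c)

infixr 6 _▷_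
_▷_ : ∀ {n} {t : Tree n} → Asg t → (Fin n → Bool) → Fin n → Bool
(α ▷ γ) x = assign α x (γ x)

-- This part of the bijectivity of a vtree passes to subtrees, as the inductions require.
Distinct : ∀ {n} → Tree n → Set
Distinct (leaf x)     = ⊤
Distinct (node t₁ t₂) =
  (∀ {x} → x ∈ₛ vars t₁ → x ∉ₛ vars t₂) × Distinct t₁ × Distinct t₂

-- The product of the automaton with itself: the pairs of nodes reached by α ▷ γ
-- and β ▷ γ for a common γ.

pairStep : ∀ {k k₁ k₂} {E : Fin k → Fin k₁ × Fin k₂ → Bool} → IsPartition E →
  (Fin k₁ × Fin k₁) × (Fin k₂ × Fin k₂) → Fin k × Fin k
pairStep part ((v , v′) , (w , w′)) = step part (v , w) , step part (v′ , w′)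

module _ {n} {s : Tree n} (α β : Asg s) where

  leafPair : ∀ {k} {lit : Fin k → Literal} → LeafConditions lit → Fin n → Bool → Fin k × Fin k
  leafPair cond x c = sat cond (assign α x c) , sat cond (assign β x c)

  reach : ∀ {k} {t : Tree n} → Diagram t k → List (Fin k × Fin k)
  -- Both values are tried even where the assignments fix `x`, and equal pairs are kept; hence the
  -- summand 2 in `length-reach`.
  reach (leaf {x} lit cond) = leafPair cond x false ∷ leafPair cond x true ∷ []
  reach (node d₁ d₂ E part) =
    representatives _==_ (pairStep part) (cartesianProduct (reach d₁) (reach d₂))

  -- Pairs of the two children come with independent completions. These can be glued into one
  -- because the children share no variable, so every combination of child pairs really occurs.
  reach-sound : ∀ {k} {t : Tree n} → Distinct t → (d : Diagram t k) → ∀ {p} →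
    p ∈ reach d → ∃[ γ ] p ≡ (run d (α ▷ γ) , run d (β ▷ γ))
  reach-sound _ (leaf lit cond) (here refl)         = (λ _ → false) , refl
  reach-sound _ (leaf lit cond) (there (here refl)) = (λ _ → true) , refl
  reach-sound (disjoint , dist₁ , dist₂) (node {t₁} {t₂} d₁ d₂ E part) p∈
    with (q , r) , qr∈ , refl ← representatives-⊆ _==_ (pairStep part) (cartesianProduct (reach d₁) (reach d₂)) p∈
    with q∈ , r∈ ← ∈-cartesianProduct⁻ (reach d₁) (reach d₂) qr∈
    with γ₁ , refl ← reach-sound dist₁ d₁ q∈
    with γ₂ , refl ← reach-sound dist₂ d₂ r∈
    = γ , cong₂ _,_
        (cong (step part) (cong₂ _,_
          (run-cong d₁ (λ {x} x∈ → cong (assign α x) (left-≡ x∈)))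
          (run-cong d₂ (λ {x} x∈ → cong (assign α x) (right-≡ x∈)))))
        (cong (step part) (cong₂ _,_
          (run-cong d₁ (λ {x} x∈ → cong (assign β x) (left-≡ x∈)))
          (run-cong d₂ (λ {x} x∈ → cong (assign β x) (right-≡ x∈)))))
    where
    γ : Fin n → Bool
    γ x = if does (x ∈? vars t₁) then γ₁ x else γ₂ x
    left-≡ : ∀ {x} → x ∈ₛ vars t₁ → γ₁ x ≡ γ x
    left-≡ {x} x∈ with x ∈? vars t₁
    ... | yes _ = refl
    ... | no x∉ = contradiction x∈ x∉
    right-≡ : ∀ {x} → x ∈ₛ vars t₂ → γ₂ x ≡ γ x
    right-≡ {x} x∈ with x ∈? vars t₁
    ... | yes x∈₁ = contradiction x∈ (disjoint x∈₁)
    ... | no _    = refl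

  reach-complete : ∀ {k} {t : Tree n} (d : Diagram t k) γ →
    (run d (α ▷ γ) , run d (β ▷ γ)) ∈ reach d
  reach-complete (leaf {x} lit cond) γ with γ x
  ... | false = here refl
  ... | true  = there (here refl)
  reach-complete (node d₁ d₂ E part) γ
    with q , q∈ , eq ← find (representatives-cover _==_ (pairStep part) ==-refl
           (cartesianProduct (reach d₁) (reach d₂))
           (∈-cartesianProduct⁺ (reach-complete d₁ γ) (reach-complete d₂ γ)))
    = subst (_∈ _) (sym (==⇒≡ (run (node d₁ d₂ E part) (α ▷ γ) , run (node d₁ d₂ E part) (β ▷ γ)) q eq)) q∈

  length-reach : ∀ {k} {t : Tree n} (d : Diagram t k) → length (reach d) ≤ 2 + k * k
  length-reach (leaf lit cond) = s≤s (s≤s z≤n)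
  length-reach (node d₁ d₂ E part) = ≤-trans
    (distinct-pairs-≤ (representatives-distinct _==_ (pairStep part) (cartesianProduct (reach d₁) (reach d₂))))
    (m≤n+m _ 2)

  agree : ∀ {k} → Fin k → Fin k × Fin k → Bool
  agree o (u , u′) = does (does (u ≟ o) Bool.≟ does (u′ ≟ o))

  equivalent : ∀ {k} {t : Tree n} → Diagram t k → Fin k → Bool
  equivalent d o = all (agree o) (reach d)

  equivalent⇔ : ∀ {k} {t : Tree n} → Distinct t → (d : Diagram t k) (o : Fin k) →
    T (equivalent d o) ⇔ (∀ γ → accepts d o (α ▷ γ) ≡ accepts d o (β ▷ γ))
  equivalent⇔ dist d o = mk⇔
    (λ t γ → does⁻ (_ Bool.≟ _) (All.lookup (all⁺ (agree o) (reach d) t) (reach-complete d γ)))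
    (λ same → all⁻ (agree o) (All.tabulate λ p∈ → agrees same (reach-sound dist d p∈)))
    where
    agrees : (∀ γ → accepts d o (α ▷ γ) ≡ accepts d o (β ▷ γ)) →
      ∀ {p} → ∃[ γ ] p ≡ (run d (α ▷ γ) , run d (β ▷ γ)) → T (agree o p)
    agrees same (γ , refl) = does⁺ (_ Bool.≟ _) (same γ)

-- Overriding, and the two forms of partial assignment

assign-∉ : ∀ {n} {t : Tree n} (α : Asg t) {x c} → x ∉ₛ vars t → assign α x c ≡ c
assign-∉ (leaf {y} b) {x} x∉ with y ≟ x
... | yes refl = contradiction (x∈⁅x⁆ y) x∉
... | no _     = refl
assign-∉ (node {t₁} {t₂} α β) x∉ =
  trans (assign-∉ α (x∉ ∘ p⊆p∪q (vars t₂))) (assign-∉ β (x∉ ∘ q⊆p∪q (vars t₁) (vars t₂)))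

assign-∈ : ∀ {n} {t : Tree n} (α : Asg t) {x c c′} → x ∈ₛ vars t → assign α x c ≡ assign α x c′
assign-∈ (leaf {y} b) {x} x∈ with y ≟ x
... | yes _  = refl
... | no y≢x = contradiction (sym (x∈⁅y⁆⇒x≡y y x∈)) y≢x
assign-∈ (node {t₁} {t₂} α β) x∈ with x∈p∪q⁻ (vars t₁) (vars t₂) x∈
... | inj₁ x∈₁ = assign-∈ α x∈₁
... | inj₂ x∈₂ = cong (assign α _) (assign-∈ β x∈₂)

-- Lets either half of a join be moved outermost, and thereby the other half be treated as part of
-- the completion.
▷-comm : ∀ {n} {t₁ t₂ : Tree n} → (∀ {x} → x ∈ₛ vars t₁ → x ∉ₛ vars t₂) →
  (α : Asg t₁) (β : Asg t₂) → ∀ γ x → (α ▷ β ▷ γ) x ≡ (β ▷ α ▷ γ) x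
▷-comm {t₁ = t₁} disjoint α β γ x with x ∈? vars t₁
... | yes x∈ = trans (assign-∈ α x∈) (sym (assign-∉ β (disjoint x∈)))
... | no x∉  = trans (assign-∉ α x∉) (cong (assign β x) (sym (assign-∉ α x∉)))

fromPartial : ∀ {n} (t : Tree n) → Partial (vars t) → Asg t
fromPartial (leaf x)     α = leaf (α x (x∈⁅x⁆ x))
fromPartial (node t₁ t₂) α = node
  (fromPartial t₁ (λ x x∈ → α x (p⊆p∪q (vars t₂) x∈)))
  (fromPartial t₂ (λ x x∈ → α x (q⊆p∪q (vars t₁) (vars t₂) x∈)))

-- The default `false` has no influence: on the variables of `t` the value is fixed by the
-- assignment (`assign-∈`).
toPartial : ∀ {n} {t : Tree n} → Asg t → Partial (vars t)
toPartial α x _ = assign α x false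

assign-fromPartial : ∀ {n} (t : Tree n) α {x c} (x∈ : x ∈ₛ vars t) →
  assign (fromPartial t α) x c ≡ α x x∈
assign-fromPartial (leaf y) α {x} x∈ with y ≟ x
... | yes refl = refl
... | no y≢x   = contradiction (sym (x∈⁅y⁆⇒x≡y y x∈)) y≢x
assign-fromPartial (node t₁ t₂) α {x} x∈ with x ∈? vars t₁
... | yes x∈₁ = assign-fromPartial t₁ _ x∈₁
... | no x∉₁ with x∈p∪q⁻ (vars t₁) (vars t₂) x∈
...   | inj₁ x∈₁ = contradiction x∈₁ x∉₁
...   | inj₂ x∈₂ = trans (assign-∉ (fromPartial t₁ _) x∉₁) (assign-fromPartial t₂ _ x∈₂)

fromPartial-toPartial : ∀ {n} {t : Tree n} (α : Asg t) γ x →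
  (fromPartial t (toPartial α) ▷ γ) x ≡ (α ▷ γ) x
fromPartial-toPartial {t = t} α γ x with x ∈? vars t
... | yes x∈ = trans (assign-fromPartial t (toPartial α) x∈) (assign-∈ α x∈)
... | no x∉  = trans (assign-∉ (fromPartial t (toPartial α)) x∉) (sym (assign-∉ α x∉))

merge-∈ : ∀ {n} {Y : Subset n} (α : Partial Y) β {x} (x∈ : x ∈ₛ Y) →
  Vec.lookup (merge α β) x ≡ α x x∈
merge-∈ {Y = Y} α β {x} x∈
  -- The local function inside `merge` is stuck on the membership test; abstracting the equation
  -- together with the test lets its type reduce in each case.
  with x ∈? Y | (Vec.lookup (merge α β) x ≡ _ ∋ lookup∘tabulate _ x)
... | yes _ | eq = eq
... | no x∉ | _  = contradiction x∈ x∉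

merge-∉ : ∀ {n} {Y : Subset n} (α : Partial Y) β {x} (x∉ : x ∉ₛ Y) →
  Vec.lookup (merge α β) x ≡ β x (x∉p⇒x∈∁p x∉)
merge-∉ {Y = Y} α β {x} x∉
  with x ∈? Y | (Vec.lookup (merge α β) x ≡ _ ∋ lookup∘tabulate _ x)
... | yes x∈ | _  = contradiction x∈ x∉
... | no _   | eq = eq

fromPartial-▷ : ∀ {n} (t : Tree n) α β {γ} →
  (∀ {x} (x∉ : x ∉ₛ vars t) → γ x ≡ β x (x∉p⇒x∈∁p x∉)) →
  ∀ x → (fromPartial t α ▷ γ) x ≡ Vec.lookup (merge α β) x
fromPartial-▷ t α β eq x with x ∈? vars t
... | yes x∈ = trans (assign-fromPartial t α x∈) (sym (merge-∈ α β x∈))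
... | no x∉  = trans (assign-∉ (fromPartial t α) x∉) (trans (eq x∉) (sym (merge-∉ α β x∉)))

Fin⇒NonZero : ∀ {k} → Fin k → NonZero k
Fin⇒NonZero {suc k} _ = _

-- The reduced diagram

module Factors {n} (f : (Fin n → Bool) → Bool)
  (f-cong : ∀ {γ γ′} → (∀ x → γ x ≡ γ′ x) → f γ ≡ f γ′)
  (_~_ : ∀ {t : Tree n} → Asg t → Asg t → Bool)
  (~⇔ : ∀ {t : Tree n} (α β : Asg t) → T (α ~ β) ⇔ (∀ γ → f (α ▷ γ) ≡ f (β ▷ γ)))
  where

  infix 4 _≈_
  -- A record, so that `α` and `β` can be inferred from a proof; the bare family of equations does
  -- not determine them.
  record _≈_ {t : Tree n} (α β : Asg t) : Set where
    constructor same
    field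
      apply : ∀ γ → f (α ▷ γ) ≡ f (β ▷ γ)

  open _≈_

  ~⇒≈ : ∀ {t : Tree n} {α β : Asg t} → T (α ~ β) → α ≈ β
  ~⇒≈ α~β = same (Equivalence.to (~⇔ _ _) α~β)

  ≈⇒~ : ∀ {t : Tree n} {α β : Asg t} → α ≈ β → T (α ~ β)
  ≈⇒~ α≈β = Equivalence.from (~⇔ _ _) (apply α≈β)

  ≈-sym : ∀ {t : Tree n} {α β : Asg t} → α ≈ β → β ≈ α
  ≈-sym α≈β = same λ γ → sym (apply α≈β γ)

  ≈-trans : ∀ {t : Tree n} {α β δ : Asg t} → α ≈ β → β ≈ δ → α ≈ δ
  ≈-trans α≈β β≈δ = same λ γ → trans (apply α≈β γ) (apply β≈δ γ)

  ~-refl : ∀ {t : Tree n} (α : Asg t) → T (α ~ α)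
  ~-refl α = ≈⇒~ (same λ _ → refl)

  -- One half is exchanged at a time, with the other half absorbed into the completion. This is why
  -- representatives of the children generate all factors of the parent.
  node-cong : ∀ {t₁ t₂ : Tree n} → Distinct (node t₁ t₂) → {α α′ : Asg t₁} {β β′ : Asg t₂} →
    α ≈ α′ → β ≈ β′ → node α β ≈ node α′ β′
  node-cong (disjoint , _) {α} {α′} {β} {β′} α≈α′ β≈β′ = same λ γ → begin
    f (α ▷ β ▷ γ)   ≡⟨ apply α≈α′ (β ▷ γ) ⟩
    f (α′ ▷ β ▷ γ)  ≡⟨ f-cong (▷-comm disjoint α′ β γ) ⟩
    f (β ▷ α′ ▷ γ)  ≡⟨ apply β≈β′ (α′ ▷ γ) ⟩
    f (β′ ▷ α′ ▷ γ) ≡⟨ f-cong (▷-comm disjoint α′ β′ γ) ⟨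
    f (α′ ▷ β′ ▷ γ) ∎
    where open ≡-Reasoning

  join : ∀ {t₁ t₂ : Tree n} (as : List (Asg t₁)) (bs : List (Asg t₂)) →
    Fin (length as) × Fin (length bs) → Asg (node t₁ t₂)
  join as bs (v , w) = node (lookup as v) (lookup bs w)

  irrelevant : Fin n → Bool
  irrelevant x = leaf {x = x} false ~ leaf true

  leafClasses : ∀ {x : Fin n} → Bool → List (Asg (leaf x))
  leafClasses true  = leaf false ∷ []
  leafClasses false = leaf false ∷ leaf true ∷ []

  leafLiteral : ∀ {x : Fin n} b → Fin (length (leafClasses {x} b)) → Literal
  leafLiteral true  _       = one
  leafLiteral false zero    = neg
  leafLiteral false (suc _) = pos

  classes : (t : Tree n) → List (Asg t)
  classes (leaf x) = leafClasses (irrelevant x)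
  classes (node t₁ t₂) = representatives _~_ (join (classes t₁) (classes t₂))
    (pairs (length (classes t₁)) (length (classes t₂)))

  width : Tree n → ℕ
  width t = length (classes t)

  rep : ∀ t → Fin (width t) → Asg t
  rep t = lookup (classes t)

  -- `b` is a variable tied to `irrelevant x` by an equation, so that the class list reduces when
  -- `b` is split.
  leaf-rep : ∀ {x : Fin n} b → b ≡ irrelevant x → ∀ (u : Fin (length (leafClasses {x} b))) c →
    T (evalLiteral (leafLiteral {x} b u) c) ⇔ T (lookup (leafClasses {x} b) u ~ leaf c)
  leaf-rep true eq zero false = mk⇔ (λ _ → ~-refl _) _
  leaf-rep true eq zero true  = mk⇔ (λ _ → subst T eq tt) _
  leaf-rep false eq zero false = mk⇔ (λ _ → ~-refl _) _
  leaf-rep false eq zero true  = mk⇔ (λ ()) (subst T (sym eq))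
  leaf-rep false eq (suc zero) false = mk⇔ (λ ()) (λ t → subst T (sym eq) (≈⇒~ (≈-sym (~⇒≈ t))))
  leaf-rep false eq (suc zero) true = mk⇔ (λ _ → ~-refl _) _

  leafConditions : ∀ {x : Fin n} b → LeafConditions (leafLiteral {x} b)
  leafConditions true = record
    { disjoint = λ { {zero} {zero} u≢u → contradiction refl u≢u }
    ; complete = λ _ → zero , tt }
  leafConditions false = record
    { disjoint = λ { {zero} {zero} u≢u → contradiction refl u≢u
                   ; {suc zero} {suc zero} u≢u → contradiction refl u≢u
                   ; {zero} {suc zero} _ (true , () , _)
                   ; {suc zero} {zero} _ (true , _ , ()) }
    ; complete = λ { false → zero , tt ; true → suc zero , tt } }

  class-of : ∀ {t : Tree n} → Distinct t → (α : Asg t) → ∃[ u ] rep t u ≈ α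
  class-of {leaf x} _ (leaf c) = u , ~⇒≈ (Equivalence.to (leaf-rep b refl u c) sat-c)
    where
    b : Bool
    b = irrelevant x
    u : Fin (width (leaf x))
    u = proj₁ (LeafConditions.complete (leafConditions {x} b) c)
    sat-c : T (evalLiteral (leafLiteral {x} b u) c)
    sat-c = proj₂ (LeafConditions.complete (leafConditions {x} b) c)
  class-of {node t₁ t₂} dist@(_ , dist₁ , dist₂) (node α β)
    with v , v≈ ← class-of dist₁ α
    with w , w≈ ← class-of dist₂ β
    with any ← representatives-cover _~_ (join (classes t₁) (classes t₂)) ~-refl
           (pairs (width t₁) (width t₂)) (∈-cartesianProduct⁺ (∈-allFin v) (∈-allFin w))
    = Any.index any , ≈-trans (≈-sym (~⇒≈ (lookup-index any))) (node-cong dist v≈ w≈)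

  rep-distinct : ∀ t {u v : Fin (width t)} → u ≢ v → ¬ (rep t u ≈ rep t v)
  rep-distinct (leaf x) = leaf-distinct _ refl
    where
    leaf-distinct : ∀ b → b ≡ irrelevant x → ∀ {u v} → u ≢ v →
      ¬ (lookup (leafClasses {x} b) u ≈ lookup (leafClasses {x} b) v)
    leaf-distinct true  eq {zero}     {zero}     u≢v _ = u≢v refl
    leaf-distinct false eq {zero}     {zero}     u≢v _ = u≢v refl
    leaf-distinct false eq {suc zero} {suc zero} u≢v _ = u≢v refl
    leaf-distinct false eq {zero}     {suc zero} _ u≈v = subst T (sym eq) (≈⇒~ u≈v)
    leaf-distinct false eq {suc zero} {zero}     _ u≈v = subst T (sym eq) (≈⇒~ (≈-sym u≈v))
  rep-distinct (node t₁ t₂) u≢v u≈v =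
    lookup-distinct {R = λ α β → ¬ T (α ~ β)} (λ ¬α~β β~α → ¬α~β (≈⇒~ (≈-sym (~⇒≈ β~α))))
      (representatives-distinct _~_ (join (classes t₁) (classes t₂)) (pairs (width t₁) (width t₂)))
      u≢v (≈⇒~ u≈v)

  -- Edges are found by a second round of tests instead of recording where each join was placed; the
  -- round obeys the same bound as the choice of representatives, and the partition property follows
  -- from equivalence alone.
  edges : ∀ t₁ t₂ → Fin (width (node t₁ t₂)) → Fin (width t₁) × Fin (width t₂) → Bool
  edges t₁ t₂ u p = rep (node t₁ t₂) u ~ join (classes t₁) (classes t₂) p

  edges-partition : ∀ {t₁ t₂} → Distinct (node t₁ t₂) → IsPartition (edges t₁ t₂)
  edges-partition {t₁} {t₂} dist = record
    { nonempty = nonempty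
    ; disjoint = λ u≢v (p , u~p , v~p) →
        rep-distinct (node t₁ t₂) u≢v (≈-trans (~⇒≈ u~p) (≈-sym (~⇒≈ v~p)))
    ; cover = λ p → let u , u≈ = class-of dist (join (classes t₁) (classes t₂) p) in u , ≈⇒~ u≈
    }
    where
    nonempty : ∀ u → ∃[ p ] T (edges t₁ t₂ u p)
    nonempty u
      with p , _ , eq ← representatives-⊆ _~_ (join (classes t₁) (classes t₂))
             (pairs (width t₁) (width t₂)) (∈-lookup u)
      = p , subst (λ α → T (rep (node t₁ t₂) u ~ α)) eq (~-refl (rep (node t₁ t₂) u))

  -- Any assignment would do: it witnesses that there is at least one factor.
  false-everywhere : (t : Tree n) → Asg t
  false-everywhere (leaf x)     = leaf false
  false-everywhere (node t₁ t₂) = node (false-everywhere t₁) (false-everywhere t₂)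

  width-nonZero : ∀ {t} → Distinct t → NonZero (width t)
  width-nonZero dist = Fin⇒NonZero (proj₁ (class-of dist (false-everywhere _)))

  diagram : ∀ t → Distinct t → Diagram t (width t)
  diagram (leaf x) dist = leaf {{width-nonZero {leaf x} dist}} (leafLiteral {x} (irrelevant x)) (leafConditions (irrelevant x))
  diagram (node t₁ t₂) dist@(_ , dist₁ , dist₂) =
    node {{width-nonZero {node t₁ t₂} dist}} (diagram t₁ dist₁) (diagram t₂ dist₂)
      (edges t₁ t₂) (edges-partition dist)

  -- The children classify the two halves of `α`, and by `node-cong` the join of the classes found
  -- is equivalent to `α`; so an edge of `u` is hit exactly when `u` represents the class of `α`.
  eval⇔ : ∀ {t} (dist : Distinct t) (u : Fin (width t)) α →
    T (eval (diagram t dist) u α) ⇔ rep t u ≈ fromPartial t α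
  eval⇔ {leaf x} dist u α = mk⇔
    (λ t → ~⇒≈ (Equivalence.to (leaf-rep (irrelevant x) refl u _) t))
    (λ u≈ → Equivalence.from (leaf-rep (irrelevant x) refl u _) (≈⇒~ u≈))
  eval⇔ {node t₁ t₂} dist@(_ , dist₁ , dist₂) u α = mk⇔ to from
    where
    to : T (eval (diagram (node t₁ t₂) dist) u α) → rep (node t₁ t₂) u ≈ fromPartial (node t₁ t₂) α
    to t
      with v , w , t′ ← any-pairs⁻ (width t₁) (width t₂) _ t
      with tE , t″ ← Equivalence.to (Bool.T-∧ {edges t₁ t₂ u (v , w)}) t′
      with t₁ , t₂ ← Equivalence.to (Bool.T-∧ {eval (diagram t₁ dist₁) v _}) t″
      = ≈-trans (~⇒≈ tE) (node-cong dist (Equivalence.to (eval⇔ dist₁ v _) t₁)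
          (Equivalence.to (eval⇔ dist₂ w _) t₂))
    from : rep (node t₁ t₂) u ≈ fromPartial (node t₁ t₂) α → T (eval (diagram (node t₁ t₂) dist) u α)
    from u≈
      with v , v≈ ← class-of dist₁ (fromPartial t₁ _)
      with w , w≈ ← class-of dist₂ (fromPartial t₂ _)
      = any-pairs⁺ (width t₁) (width t₂) _ v w (Equivalence.from Bool.T-∧
          ( ≈⇒~ (≈-trans u≈ (≈-sym (node-cong dist v≈ w≈)))
          , Equivalence.from Bool.T-∧
              (Equivalence.from (eval⇔ dist₁ v _) v≈ , Equivalence.from (eval⇔ dist₂ w _) w≈)))

  module _ (g : BoolFun n) (g≡f : ∀ a → g a ≡ f (Vec.lookup a)) where

    FactorEquivalent⇔≈ : ∀ t α β →
      FactorEquivalent g (vars t) α β ⇔ fromPartial t α ≈ fromPartial t β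
    FactorEquivalent⇔≈ t α β = mk⇔ to from
      where
      open ≡-Reasoning
      to : FactorEquivalent g (vars t) α β → fromPartial t α ≈ fromPartial t β
      to equiv = same λ γ → begin
        f (fromPartial t α ▷ γ)                       ≡⟨ f-cong (fromPartial-▷ t α (λ x _ → γ x) (λ _ → refl)) ⟩
        f (Vec.lookup (merge α (λ x _ → γ x)))   ≡⟨ g≡f _ ⟨
        g (merge α (λ x _ → γ x))                     ≡⟨ equiv (λ x _ → γ x) ⟩
        g (merge β (λ x _ → γ x))                     ≡⟨ g≡f _ ⟩
        f (Vec.lookup (merge β (λ x _ → γ x)))   ≡⟨ f-cong (fromPartial-▷ t β (λ x _ → γ x) (λ _ → refl)) ⟨
        f (fromPartial t β ▷ γ)                       ∎
      from : fromPartial t α ≈ fromPartial t β → FactorEquivalent g (vars t) α β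
      -- The completion given to `α≈β` is `merge α δ` itself: it agrees with `δ` off the variables
      -- of `t`, and its values on them are overridden on both sides.
      from α≈β δ = begin
        g (merge α δ)                                     ≡⟨ g≡f _ ⟩
        f (Vec.lookup (merge α δ))                   ≡⟨ f-cong (fromPartial-▷ t α δ (merge-∉ α δ)) ⟨
        f (fromPartial t α ▷ Vec.lookup (merge α δ)) ≡⟨ apply α≈β _ ⟩
        f (fromPartial t β ▷ Vec.lookup (merge α δ)) ≡⟨ f-cong (fromPartial-▷ t β δ (merge-∉ α δ)) ⟩
        f (Vec.lookup (merge β δ))                   ≡⟨ g≡f _ ⟨
        g (merge β δ)                                     ∎

    reducedAt : ∀ t (dist : Distinct t) → ReducedAt g (diagram t dist)
    reducedAt t dist = factor , distinct
      where
      rep≈ : ∀ (u : Fin (width t)) → fromPartial t (toPartial (rep t u)) ≈ rep t u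
      rep≈ u = same λ γ → f-cong (fromPartial-toPartial (rep t u) γ)
      factor : ∀ u → IsFactor g (vars t) (λ α → T (eval (diagram t dist) u α))
      factor u = toPartial (rep t u) , λ β → mk⇔
        (λ e → Equivalence.from (FactorEquivalent⇔≈ t _ β)
          (≈-trans (rep≈ u) (Equivalence.to (eval⇔ dist u β) e)))
        (λ e → Equivalence.from (eval⇔ dist u β)
          (≈-trans (≈-sym (rep≈ u)) (Equivalence.to (FactorEquivalent⇔≈ t _ β) e)))
      distinct : ∀ {u v} → u ≢ v → ¬ (∀ α → eval (diagram t dist) u α ≡ eval (diagram t dist) v α)
      distinct {u} {v} u≢v eval≡ = rep-distinct t u≢v (≈-trans
        (Equivalence.to (eval⇔ dist u _) (subst T (sym (eval≡ (toPartial (rep t v))))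
          (Equivalence.from (eval⇔ dist v _) (≈-sym (rep≈ v)))))
        (rep≈ v))

    reducedEverywhere : ∀ t (dist : Distinct t) → ReducedEverywhere g (diagram t dist)
    reducedEverywhere (leaf x) dist = reducedAt (leaf x) dist
    reducedEverywhere (node t₁ t₂) dist@(_ , dist₁ , dist₂) =
      reducedAt (node t₁ t₂) dist , reducedEverywhere t₁ dist₁ , reducedEverywhere t₂ dist₂

-- Leaves, variables and sizes

leaf-∈ : ∀ {n} {t : Tree n} (p : Leaf t) → label p ∈ₛ vars t
leaf-∈ (here {x})            = x∈⁅x⁆ x
leaf-∈ (left {t₁} {t₂} p)    = p⊆p∪q (vars t₂) (leaf-∈ p)
leaf-∈ (right {t₁} {t₂} p)   = q⊆p∪q (vars t₁) (vars t₂) (leaf-∈ p)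

∈-leaf : ∀ {n} (t : Tree n) {x} → x ∈ₛ vars t → ∃[ p ] label {t = t} p ≡ x
∈-leaf (leaf y) x∈ = here , sym (x∈⁅y⁆⇒x≡y y x∈)
∈-leaf (node t₁ t₂) x∈ with x∈p∪q⁻ (vars t₁) (vars t₂) x∈
... | inj₁ x∈₁ = let p , eq = ∈-leaf t₁ x∈₁ in left p , eq
... | inj₂ x∈₂ = let p , eq = ∈-leaf t₂ x∈₂ in right p , eq

injective⇒distinct : ∀ {n} (t : Tree n) →
  (∀ {p q : Leaf t} → label p ≡ label q → p ≡ q) → Distinct t
injective⇒distinct (leaf x) _ = _
injective⇒distinct (node t₁ t₂) injective =
  disjoint ,
  injective⇒distinct t₁ (left-injective ∘ injective) ,
  injective⇒distinct t₂ (right-injective ∘ injective)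
  where
  left-injective : ∀ {p q : Leaf t₁} → left {t₂ = t₂} p ≡ left q → p ≡ q
  left-injective refl = refl
  right-injective : ∀ {p q : Leaf t₂} → right {t₁ = t₁} p ≡ right q → p ≡ q
  right-injective refl = refl
  disjoint : ∀ {x} → x ∈ₛ vars t₁ → x ∉ₛ vars t₂
  disjoint x∈₁ x∈₂ with ∈-leaf t₁ x∈₁ | ∈-leaf t₂ x∈₂
  ... | p , eq | q , eq′ with injective {left p} {right q} (trans eq (sym eq′))
  ... | ()

vtree-distinct : ∀ {n} (V : VTree n) → Distinct (tree V)
vtree-distinct V = injective⇒distinct (tree V) (proj₁ (bijective V))

∈-vtree : ∀ {n} (V : VTree n) x → x ∈ₛ vars (tree V)
∈-vtree V x with proj₂ (bijective V) x
... | p , eq = subst (_∈ₛ vars (tree V)) (eq refl) (leaf-∈ p)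

leaves : ∀ {n} → Tree n → ℕ
leaves (leaf _)     = 1
leaves (node t₁ t₂) = leaves t₁ + leaves t₂

∣p∪q∣≤∣p∣+∣q∣ : ∀ {n} (p q : Subset n) → ∣ p ∪ q ∣ ≤ ∣ p ∣ + ∣ q ∣
∣p∪q∣≤∣p∣+∣q∣ Vec.[] Vec.[] = z≤n
∣p∪q∣≤∣p∣+∣q∣ (outside Vec.∷ p) (outside Vec.∷ q) = ∣p∪q∣≤∣p∣+∣q∣ p q
∣p∪q∣≤∣p∣+∣q∣ (outside Vec.∷ p) (inside  Vec.∷ q) =
  ≤-trans (s≤s (∣p∪q∣≤∣p∣+∣q∣ p q)) (≤-reflexive (sym (+-suc ∣ p ∣ ∣ q ∣)))
∣p∪q∣≤∣p∣+∣q∣ (inside  Vec.∷ p) (outside Vec.∷ q) = s≤s (∣p∪q∣≤∣p∣+∣q∣ p q)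
∣p∪q∣≤∣p∣+∣q∣ (inside  Vec.∷ p) (inside  Vec.∷ q) =
  s≤s (≤-trans (∣p∪q∣≤∣p∣+∣q∣ p q) (+-monoʳ-≤ ∣ p ∣ (n≤1+n ∣ q ∣)))

disjoint-∣∪∣ : ∀ {n} (p q : Subset n) → (∀ {x} → x ∈ₛ p → x ∉ₛ q) → ∣ p ∣ + ∣ q ∣ ≤ ∣ p ∪ q ∣
disjoint-∣∪∣ Vec.[] Vec.[] _ = z≤n
disjoint-∣∪∣ (outside Vec.∷ p) (outside Vec.∷ q) disjoint =
  disjoint-∣∪∣ p q (λ x∈p x∈q → disjoint (Vec.there x∈p) (Vec.there x∈q))
disjoint-∣∪∣ (outside Vec.∷ p) (inside  Vec.∷ q) disjoint =
  ≤-trans (≤-reflexive (+-suc ∣ p ∣ ∣ q ∣))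
    (s≤s (disjoint-∣∪∣ p q (λ x∈p x∈q → disjoint (Vec.there x∈p) (Vec.there x∈q))))
disjoint-∣∪∣ (inside  Vec.∷ p) (outside Vec.∷ q) disjoint =
  s≤s (disjoint-∣∪∣ p q (λ x∈p x∈q → disjoint (Vec.there x∈p) (Vec.there x∈q)))
disjoint-∣∪∣ (inside  Vec.∷ p) (inside  Vec.∷ q) disjoint =
  contradiction Vec.here (disjoint Vec.here)

∣vars∣≤leaves : ∀ {n} (t : Tree n) → ∣ vars t ∣ ≤ leaves t
∣vars∣≤leaves (leaf x)     = ≤-reflexive (∣⁅x⁆∣≡1 x)
∣vars∣≤leaves (node t₁ t₂) = ≤-trans (∣p∪q∣≤∣p∣+∣q∣ (vars t₁) (vars t₂))
  (+-mono-≤ (∣vars∣≤leaves t₁) (∣vars∣≤leaves t₂))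

leaves≤∣vars∣ : ∀ {n} (t : Tree n) → Distinct t → leaves t ≤ ∣ vars t ∣
leaves≤∣vars∣ (leaf x) _ = ≤-reflexive (sym (∣⁅x⁆∣≡1 x))
leaves≤∣vars∣ (node t₁ t₂) (disjoint , dist₁ , dist₂) = ≤-trans
  (+-mono-≤ (leaves≤∣vars∣ t₁ dist₁) (leaves≤∣vars∣ t₂ dist₂))
  (disjoint-∣∪∣ (vars t₁) (vars t₂) disjoint)

nonZero⇒≥1 : ∀ k .{{_ : NonZero k}} → 1 ≤ k
nonZero⇒≥1 (suc k) = s≤s z≤n

leaves≤size : ∀ {n k} {t : Tree n} (d : Diagram t k) → leaves t ≤ diagramSize d
leaves≤size (leaf {k = k} _ _) = nonZero⇒≥1 k
leaves≤size (node {k = k} d₁ d₂ _ _) =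
  ≤-trans (+-mono-≤ (leaves≤size d₁) (leaves≤size d₂)) (m≤n+m _ k)

-- Each variable has a leaf and each leaf a node. As the target vtree has at most `n` leaves, its
-- assignments and labels are thereby also measured by the size of the given diagram.
variables≤size : ∀ {n k} (V : VTree n) (d : Diagram (tree V) k) → n ≤ diagramSize d
variables≤size {n} V d = begin
  n                   ≡⟨ ∣⊤∣≡n n ⟨
  ∣ ⊤ₛ {n} ∣           ≤⟨ p⊆q⇒∣p∣≤∣q∣ {p = ⊤ₛ} (λ {x} _ → ∈-vtree V x) ⟩
  ∣ vars (tree V) ∣   ≤⟨ ∣vars∣≤leaves (tree V) ⟩
  leaves (tree V)     ≤⟨ leaves≤size d ⟩
  diagramSize d       ∎
  where open ≤-Reasoning

leaves≤variables : ∀ {n} (t : Tree n) → Distinct t → leaves t ≤ n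
leaves≤variables t dist = ≤-trans (leaves≤∣vars∣ t dist) (∣p∣≤n (vars t))

width≤size : ∀ {n k} {t : Tree n} (d : Diagram t k) → k ≤ diagramSize d
width≤size (leaf _ _)                 = ≤-refl
width≤size (node {k = k} d₁ d₂ _ _)   = m≤m+n k _

-- Output labels at the root

rootLabel : Bool → Bool → Fin 2
-- `b` is the value of the function on the class of node `zero`; that node receives the label equal
-- to its value, and the other node the other label.
rootLabel b c = if does (b Bool.≟ c) then zero else suc zero

rootLabel-bijective : ∀ b → Bijective _≡_ _≡_ (rootLabel b)
rootLabel-bijective b = injective b _ _ , surjective b
  where
  injective : ∀ b c c′ → rootLabel b c ≡ rootLabel b c′ → c ≡ c′
  injective false false false _ = refl
  injective false true  true  _ = refl
  injective true  false false _ = refl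
  injective true  true  true  _ = refl
  surjective : ∀ b u → ∃[ c ] ∀ {c′} → c′ ≡ c → rootLabel b c′ ≡ u
  surjective false zero       = false , λ { refl → refl }
  surjective false (suc zero) = true  , λ { refl → refl }
  surjective true  zero       = true  , λ { refl → refl }
  surjective true  (suc zero) = false , λ { refl → refl }

only-label-bijective : ∀ (c : Bool) → Bijective _≡_ _≡_ (λ (_ : ∃[ ℓ ] ℓ ≡ c) → Fin 1 ∋ zero)
only-label-bijective c =
  (λ { {_ , refl} {_ , refl} _ → refl }) , λ { zero → (c , refl) , λ _ → refl }

-- The final branch of the program depends only on whether there is a second class, so only the tail
-- of the class list and the value `b` of its head enter.
encodeRoots : ∀ {A : Set} → List A → Bool → Value → Value
encodeRoots []      b d = (nil ∙ nil) ∙ d ∙ encodeBool b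
encodeRoots (_ ∷ _) b d = nil ∙ d ∙ encodeFin (rootLabel b false) ∙ encodeFin (rootLabel b true)

T-injective : ∀ {a b} → T a ⇔ T b → a ≡ b
T-injective {false} {false} _ = refl
T-injective {false} {true}  e = ⊥-elim (Equivalence.from e _)
T-injective {true}  {false} e = ⊥-elim (Equivalence.to e _)
T-injective {true}  {true}  _ = refl

module Roots {n} (f : (Fin n → Bool) → Bool)
  (f-cong : ∀ {γ γ′} → (∀ x → γ x ≡ γ′ x) → f γ ≡ f γ′)
  (_~_ : ∀ {t : Tree n} → Asg t → Asg t → Bool)
  (~⇔ : ∀ {t : Tree n} (α β : Asg t) → T (α ~ β) ⇔ (∀ γ → f (α ▷ γ) ≡ f (β ▷ γ)))
  (W : VTree n) where

  open Factors f f-cong _~_ ~⇔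

  private
    t = tree W

  value : Asg t → Bool
  value α = f (α ▷ λ _ → false)

  value-▷ : ∀ α γ → f (α ▷ γ) ≡ value α
  value-▷ α γ = f-cong (λ x → assign-∈ α (∈-vtree W x))

  -- No variable is free at the root, so equivalence there is the equality of one bit. This leaves
  -- at most two classes.
  value⇒≈ : ∀ {α β} → value α ≡ value β → α ≈ β
  value⇒≈ {α} {β} eq = same λ γ → trans (value-▷ α γ) (trans eq (sym (value-▷ β γ)))

  ≈⇒value : ∀ {α β} → α ≈ β → value α ≡ value β
  ≈⇒value (same eq) = eq _

  value-total : ∀ a → value (fromPartial t (total a)) ≡ f (Vec.lookup a)
  value-total a = f-cong (λ x → assign-fromPartial t (total a) (∈-vtree W x))

  -- Stated for an arbitrary list, since the number of root nodes is decided by splitting it, which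
  -- the computed list `classes t` does not permit.
  record IsClassDiagram (αs : List (Asg t)) (d : Diagram t (length αs)) : Set where
    field
      covers   : ∀ α → ∃[ u ] lookup αs u ≈ α
      distinct : ∀ {u v} → u ≢ v → ¬ (lookup αs u ≈ lookup αs v)
      eval⇔≈   : ∀ u α → T (eval d u α) ⇔ lookup αs u ≈ fromPartial t α
      reduced  : ∀ g → (∀ a → g a ≡ f (Vec.lookup a)) → ReducedEverywhere g d

    distinct-value : ∀ {u v} → u ≢ v → value (lookup αs u) ≢ value (lookup αs v)
    distinct-value u≢v eq = distinct u≢v (value⇒≈ eq)

    eval⇔value : ∀ u a → T (eval d u (total a)) ⇔ value (lookup αs u) ≡ f (Vec.lookup a)
    eval⇔value u a = mk⇔
      (λ e → trans (≈⇒value (Equivalence.to (eval⇔≈ u (total a)) e)) (value-total a))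
      (λ eq → Equivalence.from (eval⇔≈ u (total a)) (value⇒≈ (trans eq (sym (value-total a)))))

  classDiagram : (dist : Distinct t) → IsClassDiagram (classes t) (diagram t dist)
  classDiagram dist = record
    { covers   = class-of dist
    ; distinct = rep-distinct t
    ; eval⇔≈   = eval⇔ dist
    ; reduced  = λ g g≡f → reducedEverywhere g g≡f t dist
    }

  no-three : ∀ (a b c : Bool) → a ≢ b → a ≢ c → b ≢ c → ⊥
  no-three false false _ a≢b _ _ = a≢b refl
  no-three false true false _ a≢c _ = a≢c refl
  no-three false true true _ _ b≢c = b≢c refl
  no-three true true _ a≢b _ _ = a≢b refl
  no-three true false true _ a≢c _ = a≢c refl
  no-three true false false _ _ b≢c = b≢c refl

  -- Two nodes of the root are told apart by the value of f, so there is one of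
  -- them or one for each output.
  withOutputs : ∀ α αs (d : Diagram t (length (α ∷ αs))) → IsClassDiagram (α ∷ αs) d →
    Σ (BooleanTDD₁ W) λ D′ → Reduced D′ × (∀ a → computes₁ D′ a ≡ f (Vec.lookup a)) ×
      size₁ D′ ≡ diagramSize d × encodeTDD D′ ≡ encodeRoots αs (value α) (encodeDiagram d)
  withOutputs α [] d isClass = D′ , reduced (computes₁ D′) correct , correct , refl , refl
    where
    open IsClassDiagram isClass
    TDD′ : TDD W (∃[ ℓ ] ℓ ≡ value α)
    TDD′ = record { width = 1 ; diagram = d ; output = λ _ → zero ; bijective = only-label-bijective (value α) }
    D′ : BooleanTDD₁ W
    D′ = single (value α) TDD′
    constant : ∀ a → value α ≡ f (Vec.lookup a)
    constant a with covers (fromPartial t (total a))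
    ... | zero , α≈ = trans (≈⇒value α≈) (value-total a)
    correct-single : ∀ b (D : TDD W (∃[ ℓ ] ℓ ≡ b)) → TDD.width D ≡ 1 → (∀ a → b ≡ f (Vec.lookup a)) →
      (∀ u a → T (eval (TDD.diagram D) u (total a))) →
      ∀ a → computes₁ (single b D) a ≡ f (Vec.lookup a)
    correct-single false D _ eq _ a = eq a
    correct-single true D _ eq always a = trans (Equivalence.to Bool.T-≡ (always _ a)) (eq a)
    correct : ∀ a → computes₁ D′ a ≡ f (Vec.lookup a)
    correct = correct-single (value α) TDD′ refl constant
      λ { zero a → Equivalence.from (eval⇔value zero a) (constant a) }
  withOutputs α (β ∷ []) d isClass = D′ , reduced (computes₁ D′) correct , correct , refl , refl
    where
    open IsClassDiagram isClass
    D′ : BooleanTDD₁ W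
    D′ = full (record { width = 2 ; diagram = d ; output = rootLabel (value α) ; bijective = rootLabel-bijective (value α) })
    trueNode : Fin 2
    trueNode = rootLabel (value α) true
    other-value : ∀ b → value α ≡ false → value β ≡ b → b ≡ true
    other-value true  _ _ = refl
    other-value false eq eq′ = contradiction (trans eq (sym eq′)) (distinct-value {zero} {suc zero} λ ())
    value-rootLabel : ∀ b → value α ≡ b → value (lookup (α ∷ β ∷ []) (rootLabel b true)) ≡ true
    value-rootLabel true  eq = eq
    value-rootLabel false eq = other-value (value β) eq refl
    value-trueNode : value (lookup (α ∷ β ∷ []) trueNode) ≡ true
    value-trueNode = value-rootLabel (value α) refl
    correct : ∀ a → computes₁ D′ a ≡ f (Vec.lookup a)
    correct a = T-injective (mk⇔
      (λ e → subst T (trans (sym value-trueNode) (Equivalence.to (eval⇔value trueNode a) e)) _)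
      (λ e → Equivalence.from (eval⇔value trueNode a)
        (trans value-trueNode (sym (Equivalence.to Bool.T-≡ e)))))
  withOutputs α (β ∷ β′ ∷ _) d isClass = ⊥-elim (no-three (value α) (value β) (value β′)
    (distinct-value {zero} {suc zero} λ ()) (distinct-value {zero} {suc (suc zero)} λ ())
    (distinct-value {suc zero} {suc (suc zero)} λ ()))
    where open IsClassDiagram isClass

-- Runs of folds, equality tests and the product automaton

-- The value h xs is computed from the back of the list; P holds of every
-- suffix that the fold passes through.
fold-runs : ∀ {A : Set} {self step} → code self ≡ foldCode self step →
  (enc : A → Value) (h : List A → Value) (P : List A → Set) {ctx : Value} {B : ℕ} →
  (∀ x ys → P (x ∷ ys) → P ys × Runs step (ctx ∙ enc x ∙ h ys) (h (x ∷ ys)) B) →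
  ∀ xs {L} → P xs → length xs ≤ L →
  Runs self (ctx ∙ h [] ∙ encodeList enc xs) (h xs) (K + L * (K + B))
fold-runs {self = self} is-fold enc h P step-runs [] p len =
  by-wp (subst (λ e → wp e (_ ∷ []) 0 0 (Returns (h []) _)) (sym is-fold)
    (refl , ticks z≤n))
fold-runs {self = self} is-fold enc h P {ctx} {B} step-runs (x ∷ xs) {suc L} p (s≤s len) =
  by-wp (subst (λ e → wp e (_ ∷ []) 0 0 (Returns (h (x ∷ xs)) _)) (sym is-fold)
    (fold-runs is-fold enc h P step-runs xs (proj₁ (step-runs x xs p)) len
      ▸ proj₂ (step-runs x xs p)
      ▸ refl , ticks (≤-reflexive rearrange)))
  where
  open ≡-Reasoning
  rearrange : K + L * (K + B) + B ≡ K + B + L * (K + B)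
  rearrange = begin
    K + L * (K + B) + B   ≡⟨ +-assoc K (L * (K + B)) B ⟩
    K + (L * (K + B) + B) ≡⟨ cong (K +_) (+-comm (L * (K + B)) B) ⟩
    K + (B + L * (K + B)) ≡⟨ +-assoc K B (L * (K + B)) ⟨
    K + B + L * (K + B)   ∎

foldAll-runs : ∀ {A : Set} {self step} → code self ≡ foldCode self step →
  (enc : A → Value) (h : List A → Value) {ctx : Value} {B : ℕ} →
  (∀ x ys → Runs step (ctx ∙ enc x ∙ h ys) (h (x ∷ ys)) B) →
  ∀ xs {L} → length xs ≤ L →
  Runs self (ctx ∙ h [] ∙ encodeList enc xs) (h xs) (K + L * (K + B))
foldAll-runs is-fold enc h step-runs xs =
  fold-runs is-fold enc h (λ _ → ⊤) (λ x ys _ → tt , step-runs x ys) xs tt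

cross-runs : ∀ {A B : Set} (enc : A → Value) (enc′ : B → Value) xs ys {L L′} →
  length xs ≤ L → length ys ≤ L′ →
  Runs crossF (encodeList enc′ ys ∙ nil ∙ encodeList enc xs)
    (encodeList (λ (x , y) → enc x ∙ enc′ y) (cartesianProduct xs ys))
    (K + L * (K + (K + (K + L′ * (K + K)))))
cross-runs {A} {B} enc enc′ xs ys {L} {L′} len len′ =
  foldAll-runs refl enc (λ xs → encodeList encPair (cartesianProduct xs ys)) cross-step xs len
  where
  encPair : A × B → Value
  encPair (x , y) = enc x ∙ enc′ y
  cross-step : ∀ x xs → Runs crossStepF
    (encodeList enc′ ys ∙ enc x ∙ encodeList encPair (cartesianProduct xs ys))
    (encodeList encPair (cartesianProduct (x ∷ xs) ys)) (K + (K + L′ * (K + K)))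
  cross-step x xs = by-wp
    (foldAll-runs refl enc′ (λ zs → encodeList encPair (map (x ,_) zs ++ cartesianProduct xs ys))
      (λ y zs → by-wp (refl , ticks₀)) ys len′
    ▸ refl , ticks ≤-refl)

infix 4 _=ᵛ_
_=ᵛ_ : Value → Value → Bool
nil     =ᵛ nil     = true
nil     =ᵛ _ ∙ _   = false
_ ∙ _   =ᵛ nil     = false
a ∙ b   =ᵛ a′ ∙ b′ = (a =ᵛ a′) ∧ (b =ᵛ b′)

valueSize : Value → ℕ
valueSize nil     = 1
valueSize (a ∙ b) = suc (valueSize a + valueSize b)

-- Both values are traversed in step and the first mismatch ends the run, so the size of the first
-- one bounds the cost.
equal-runs : ∀ a b → Runs equalF (a ∙ b) (encodeBool (a =ᵛ b)) (valueSize a * K)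
equal-runs nil nil         = by-wp (refl , ticks z≤n)
equal-runs nil (_ ∙ _)     = by-wp (refl , ticks z≤n)
equal-runs (_ ∙ _) nil     = by-wp (refl , ticks z≤n)
equal-runs (a ∙ b) (a′ ∙ b′) = go (a =ᵛ a′) (equal-runs a a′)
  where
  -- The outcome of the inner test is generalised to a variable, so that splitting it resolves the
  -- branch of the program. The helpers `go` below use the same device.
  go : ∀ c → Runs equalF (a ∙ a′) (encodeBool c) (valueSize a * K) →
    Runs equalF ((a ∙ b) ∙ (a′ ∙ b′)) (encodeBool (c ∧ (b =ᵛ b′))) (valueSize (a ∙ b) * K)
  go false r = by-wp (r ▸ refl , ticks (*-monoˡ-≤ K (m≤m+n (valueSize a) (valueSize b))))
  go true  r = by-wp (r ▸ equal-runs b b′ ▸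
    refl , ticks (≤-reflexive (sym (*-distribʳ-+ K (valueSize a) (valueSize b)))))

encodeFin-=ᵛ : ∀ {k} (u v : Fin k) → (encodeFin u =ᵛ encodeFin v) ≡ does (u ≟ v)
encodeFin-=ᵛ zero    zero    = refl
encodeFin-=ᵛ zero    (suc v) = refl
encodeFin-=ᵛ (suc u) zero    = refl
encodeFin-=ᵛ (suc u) (suc v) = encodeFin-=ᵛ u v

encodeBool-=ᵛ : ∀ a b → (encodeBool a =ᵛ encodeBool b) ≡ does (a Bool.≟ b)
encodeBool-=ᵛ false false = refl
encodeBool-=ᵛ false true  = refl
encodeBool-=ᵛ true  false = refl
encodeBool-=ᵛ true  true  = refl

valueSize-encodeFin : ∀ {k} (u : Fin k) → valueSize (encodeFin u) ≤ k + k
valueSize-encodeFin {suc k} zero    = s≤s z≤n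
valueSize-encodeFin {suc k} (suc u) =
  ≤-trans (s≤s (s≤s (valueSize-encodeFin u))) (≤-reflexive (cong suc (sym (+-suc k k))))

encodeAsg : ∀ {n} {t : Tree n} → Asg t → Value
encodeAsg (leaf {x} b) = nil ∙ encodeFin x ∙ encodeBool b
encodeAsg (node α β)   = (nil ∙ nil) ∙ encodeAsg α ∙ encodeAsg β

nodes : ∀ {n} → Tree n → ℕ
nodes (leaf _)     = 1
nodes (node t₁ t₂) = suc (nodes t₁ + nodes t₂)

1+nodes≡2*leaves : ∀ {n} (t : Tree n) → suc (nodes t) ≡ leaves t + leaves t
1+nodes≡2*leaves (leaf _) = refl
1+nodes≡2*leaves (node t₁ t₂) = begin
  suc (suc (nodes t₁ + nodes t₂))    ≡⟨ cong suc (+-suc (nodes t₁) (nodes t₂)) ⟨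
  suc (nodes t₁) + suc (nodes t₂)    ≡⟨ cong₂ _+_ (1+nodes≡2*leaves t₁) (1+nodes≡2*leaves t₂) ⟩
  (a + a) + (b + b)                  ≡⟨ interchange +-commutativeSemigroup a a b b ⟩
  (a + b) + (a + b)                  ∎
  where
  open ≡-Reasoning
  a b : ℕ
  a = leaves t₁
  b = leaves t₂

nodes≤2*leaves : ∀ {n} (t : Tree n) → nodes t ≤ leaves t + leaves t
nodes≤2*leaves t = ≤-trans (n≤1+n _) (≤-reflexive (1+nodes≡2*leaves t))

length-allFin : ∀ k → length (allFin k) ≡ k
length-allFin k = length-tabulate {n = k} id

length-cartesianProduct : ∀ {A B : Set} (xs : List A) (ys : List B) →
  length (cartesianProduct xs ys) ≡ length xs * length ys
length-cartesianProduct []       ys = refl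
length-cartesianProduct (x ∷ xs) ys = trans (length-++ (map (x ,_) ys))
  (cong₂ _+_ (length-map (x ,_) ys) (length-cartesianProduct xs ys))

length-pairs : ∀ k l → length (pairs k l) ≡ k * l
length-pairs k l = trans (length-cartesianProduct (allFin k) (allFin l)) (cong₂ _*_ (length-allFin k) (length-allFin l))

-- The program has no access to `E`, only to the list that encodes a set; membership in that list
-- gives back the truth value.
any-filter-pairs : ∀ {k l} (f : Fin k × Fin l → Bool) p → any (p ==_) (filterᵇ f (pairs k l)) ≡ f p
any-filter-pairs {k} {l} f p = T-injective (mk⇔ to from)
  where
  to : T (any (p ==_) (filterᵇ f (pairs k l))) → T (f p)
  to t with find (any⁻ (p ==_) (filterᵇ f (pairs k l)) t)
  ... | q , q∈ , p==q = subst (T ∘ f) (sym (==⇒≡ p q p==q)) (proj₂ (∈-filter⁻ (T? ∘ f) {xs = pairs k l} q∈))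
  from : T (f p) → T (any (p ==_) (filterᵇ f (pairs k l)))
  from t = any⁺ (p ==_) (lose (∈-filter⁺ (T? ∘ f) (∈-cartesianProduct⁺ (∈-allFin (proj₁ p)) (∈-allFin (proj₂ p))) t) (==-refl p))

-- The variable 𝕏 stands for the size of the given diagram.

pK cEq cLook cLits cLeafPair cElem cIndex cInsertStep cReachLength cCross cInsert cNode cAgree cEquivalent : Poly
pK           = const K
-- The size of a pair of indices: one cell and two unary numerals, each of size at most `𝕏 ⊕ 𝕏`.
cEq          = (const 1 ⊕ (𝕏 ⊕ 𝕏) ⊕ (𝕏 ⊕ 𝕏)) ⊗ pK
cLook        = (𝕏 ⊕ 𝕏) ⊗ (pK ⊕ cEq)
cLits        = pK ⊕ 𝕏 ⊗ (pK ⊕ pK)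
cLeafPair    = pK ⊕ (cLook ⊕ cLits ⊕ cLook ⊕ cLits)
cElem        = pK ⊕ 𝕏 ⊗ 𝕏 ⊗ (pK ⊕ (pK ⊕ cEq))
cIndex       = pK ⊕ 𝕏 ⊗ (pK ⊕ (pK ⊕ cElem))
cInsertStep  = pK ⊕ (cIndex ⊕ cIndex ⊕ cElem)
cReachLength = const 2 ⊕ 𝕏 ⊗ 𝕏
cCross       = pK ⊕ cReachLength ⊗ (pK ⊕ (pK ⊕ (pK ⊕ cReachLength ⊗ (pK ⊕ pK))))
cInsert      = pK ⊕ (cReachLength ⊗ cReachLength) ⊗ (pK ⊕ cInsertStep)
-- The costs at a leaf and at an inner node are added, so that one polynomial is valid at every node
-- of the diagram.
cNode        = (pK ⊕ (cLeafPair ⊕ cLeafPair)) ⊕ (cCross ⊕ cInsert)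
cAgree       = pK ⊕ cReachLength ⊗ (pK ⊕ (pK ⊕ (cEq ⊕ cEq ⊕ cEq)))
cEquivalent  = pK ⊕ ((𝕏 ⊕ 𝕏) ⊗ cNode ⊕ cAgree)

module Bounded {n : ℕ} (M : ℕ) (n≤M : n ≤ M) (1≤M : 1 ≤ M) where

  equal-bounded : ∀ {a b} → valueSize a ≤ 1 + (M + M) + (M + M) →
    Runs equalF (a ∙ b) (encodeBool (a =ᵛ b)) (cEq at M)
  equal-bounded {a} {b} small = weaken (*-monoˡ-≤ K small) (equal-runs a b)

  valueSize-bounded : ∀ {k} → k ≤ M → (u : Fin k) → valueSize (encodeFin u) ≤ M + M
  valueSize-bounded k≤M u = ≤-trans (valueSize-encodeFin u) (+-mono-≤ k≤M k≤M)

  equal-Fin : ∀ {k} → k ≤ M → (u v : Fin k) →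
    Runs equalF (encodeFin u ∙ encodeFin v) (encodeBool (does (u ≟ v))) (cEq at M)
  equal-Fin k≤M u v = result (cong encodeBool (encodeFin-=ᵛ u v)) (equal-bounded
    (≤-trans (valueSize-bounded k≤M u) (≤-trans (n≤1+n _) (m≤m+n _ _))))

  equal-pair : ∀ {k l} → k ≤ M → l ≤ M → (p q : Fin k × Fin l) →
    Runs equalF (encodePair p ∙ encodePair q) (encodeBool (p == q)) (cEq at M)
  equal-pair k≤M l≤M (u , v) (u′ , v′) =
    result (cong encodeBool (cong₂ _∧_ (encodeFin-=ᵛ u u′) (encodeFin-=ᵛ v v′)))
      (equal-bounded (s≤s (+-mono-≤ (valueSize-bounded k≤M u) (valueSize-bounded l≤M v))))

  equal-Bool : ∀ a b → Runs equalF (encodeBool a ∙ encodeBool b) (encodeBool (does (a Bool.≟ b))) (cEq at M)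
  equal-Bool a b = result (cong encodeBool (encodeBool-=ᵛ a b)) (equal-bounded (small a))
    where
    small : ∀ a → valueSize (encodeBool a) ≤ 1 + (M + M) + (M + M)
    small false = s≤s z≤n
    small true  = s≤s (≤-trans (+-mono-≤ 1≤M 1≤M) (m≤m+n (M + M) (M + M)))

  look-nodes : ∀ {t : Tree n} (α : Asg t) x c →
    Runs lookF (encodeAsg α ∙ encodeFin x ∙ encodeBool c) (encodeBool (assign α x c))
      (nodes t * (K + cEq at M))
  look-nodes (leaf {y} b) x c = go (does (y ≟ x)) (equal-Fin n≤M y x)
    where
    bound : K + cEq at M ≤ 1 * (K + cEq at M)
    bound = ≤-reflexive (sym (*-identityˡ _))
    go : ∀ e → Runs equalF (encodeFin y ∙ encodeFin x) (encodeBool e) (cEq at M) →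
      Runs lookF (encodeAsg (leaf {x = y} b) ∙ encodeFin x ∙ encodeBool c)
        (encodeBool (if e then b else c)) (1 * (K + cEq at M))
    go false r = weaken bound (by-wp (r ▸ refl , ticks ≤-refl))
    go true  r = weaken bound (by-wp (r ▸ refl , ticks ≤-refl))
  look-nodes (node {t₁} {t₂} α β) x c = by-wp
    (look-nodes β x c ▸ look-nodes α x (assign β x c) ▸ refl , within (begin
      -- 21 is the number of elementary steps on this branch of `lookF` outside its calls; 33 for
      -- `reachF` and 57 for `buildF` arise in the same way. The costs of the calls stand in the
      -- order of evaluation.
      21 + (nodes t₂ * C + nodes t₁ * C)  ≤⟨ Within.total-≤ (ticks {k = 21} ≤-refl) ⟩
      K + (nodes t₂ * C + nodes t₁ * C)   ≡⟨ cong (K +_) (+-comm (nodes t₂ * C) (nodes t₁ * C)) ⟩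
      K + (nodes t₁ * C + nodes t₂ * C)   ≡⟨ cong (K +_) (*-distribʳ-+ C (nodes t₁) (nodes t₂)) ⟨
      K + (nodes t₁ + nodes t₂) * C       ≤⟨ +-monoˡ-≤ _ (m≤m+n K (cEq at M)) ⟩
      C + (nodes t₁ + nodes t₂) * C       ∎))
    where
    open ≤-Reasoning
    C : ℕ
    C = K + cEq at M

  look-runs : ∀ {t : Tree n} → leaves t ≤ M → (α : Asg t) → ∀ x c →
    Runs lookF (encodeAsg α ∙ encodeFin x ∙ encodeBool c) (encodeBool (assign α x c)) (cLook at M)
  look-runs {t} leaves≤M α x c = weaken
    (*-monoˡ-≤ _ (≤-trans (nodes≤2*leaves t) (+-mono-≤ leaves≤M leaves≤M))) (look-nodes α x c)

  literalStep-runs : ∀ b l i → Runs literalStepF (encodeBool b ∙ encodeLiteral l ∙ encodeℕ i)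
    (encodeℕ (if evalLiteral l b then 0 else suc i)) K
  literalStep-runs false pos  i = by-wp (refl , ticks₀)
  literalStep-runs true  pos  i = by-wp (refl , ticks₀)
  literalStep-runs false neg  i = by-wp (refl , ticks₀)
  literalStep-runs true  neg  i = by-wp (refl , ticks₀)
  literalStep-runs false zero i = by-wp (refl , ticks₀)
  literalStep-runs true  zero i = by-wp (refl , ticks₀)
  literalStep-runs false one  i = by-wp (refl , ticks₀)
  literalStep-runs true  one  i = by-wp (refl , ticks₀)

  literalIndex-runs : ∀ {k} → k ≤ M → {lit : Fin k → Literal} (cond : LeafConditions lit) → ∀ b →
    Runs literalIndexF (encodeBool b ∙ nil ∙ encodeList (λ u → encodeLiteral (lit u)) (allFin k))
      (encodeFin (sat cond b)) (cLits at M)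
  literalIndex-runs {k} k≤M {lit} cond b = result
    (cong encodeℕ (position-tabulate id (λ u → evalLiteral (lit u) b) (sat cond b)
      (proj₂ (LeafConditions.complete cond b)) (λ v → sat-unique cond b)))
    (foldAll-runs refl (λ u → encodeLiteral (lit u))
      (λ us → encodeℕ (position (λ u → evalLiteral (lit u) b) us))
      (λ u us → literalStep-runs b (lit u) _)
      (allFin k) (≤-trans (≤-reflexive (length-allFin k)) k≤M))

  leafPair-runs : ∀ {s : Tree n} → leaves s ≤ M → (α β : Asg s) → ∀ {k} → k ≤ M →
    {lit : Fin k → Literal} (cond : LeafConditions lit) → ∀ x c →
    Runs leafPairF (encodeBool c ∙ encodeAsg α ∙ encodeAsg β ∙ encodeFin x ∙
        encodeList (λ u → encodeLiteral (lit u)) (allFin k))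
      (encodePair (leafPair α β cond x c)) (cLeafPair at M)
  leafPair-runs leaves≤M α β k≤M cond x c = by-wp
    ( look-runs leaves≤M α x c ▸ literalIndex-runs k≤M cond (assign α x c)
    ▸ look-runs leaves≤M β x c ▸ literalIndex-runs k≤M cond (assign β x c)
    ▸ refl , ticks ≤-refl)

  elem-runs : ∀ {k l} → k ≤ M → l ≤ M → (p : Fin k × Fin l) → ∀ qs → length qs ≤ M * M →
    Runs elemF (encodePair p ∙ nil ∙ encodeList encodePair qs) (encodeBool (any (p ==_) qs)) (cElem at M)
  elem-runs k≤M l≤M p qs len =
    foldAll-runs refl encodePair (λ qs → encodeBool (any (p ==_) qs)) (λ q qs → elemStep q qs) qs len
    where
    go : ∀ q acc b → Runs equalF (encodePair p ∙ encodePair q) (encodeBool b) (cEq at M) →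
      Runs elemStepF (encodePair p ∙ encodePair q ∙ encodeBool acc) (encodeBool (b ∨ acc)) (K + cEq at M)
    go q acc false r = by-wp (r ▸ refl , ticks ≤-refl)
    go q acc true  r = by-wp (r ▸ refl , ticks ≤-refl)
    elemStep : ∀ q qs → Runs elemStepF (encodePair p ∙ encodePair q ∙ encodeBool (any (p ==_) qs))
      (encodeBool (any (p ==_) (q ∷ qs))) (K + cEq at M)
    elemStep q qs = go q _ (p == q) (equal-pair k≤M l≤M p q)

  module _ {k k₁ k₂} (k≤M : k ≤ M) (k₁≤M : k₁ ≤ M) (k₂≤M : k₂ ≤ M)
    {E : Fin k → Fin k₁ × Fin k₂ → Bool} (part : IsPartition E) where

    encodedEdges : Value
    encodedEdges = encodeList (λ u → encodeList encodePair (filterᵇ (E u) (pairs k₁ k₂))) (allFin k)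

    length-edges : ∀ u → length (filterᵇ (E u) (pairs k₁ k₂)) ≤ M * M
    length-edges u = begin
      length (filterᵇ (E u) (pairs k₁ k₂)) ≤⟨ length-filter (T? ∘ E u) (pairs k₁ k₂) ⟩
      length (pairs k₁ k₂)                 ≡⟨ length-pairs k₁ k₂ ⟩
      k₁ * k₂                              ≤⟨ *-mono-≤ k₁≤M k₂≤M ⟩
      M * M                                ∎
      where open ≤-Reasoning

    index-runs : ∀ p → Runs indexF (encodePair p ∙ nil ∙ encodedEdges) (encodeFin (step part p)) (cIndex at M)
    index-runs p = result
      (cong encodeℕ (position-tabulate id (λ u → E u p) (step part p)
        (proj₂ (IsPartition.cover part p)) (λ v → step-unique part p)))
      (foldAll-runs refl (λ u → encodeList encodePair (filterᵇ (E u) (pairs k₁ k₂)))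
        (λ us → encodeℕ (position (λ u → E u p) us)) (λ u us → indexStep u us)
        (allFin k) (≤-trans (≤-reflexive (length-allFin k)) k≤M))
      where
      go : ∀ u i b → Runs elemF (encodePair p ∙ nil ∙ encodeList encodePair (filterᵇ (E u) (pairs k₁ k₂)))
          (encodeBool b) (cElem at M) →
        Runs indexStepF (encodePair p ∙ encodeList encodePair (filterᵇ (E u) (pairs k₁ k₂)) ∙ encodeℕ i)
          (encodeℕ (if b then 0 else suc i)) (K + cElem at M)
      go u i false r = by-wp (r ▸ refl , ticks ≤-refl)
      go u i true  r = by-wp (r ▸ refl , ticks ≤-refl)
      indexStep : ∀ u us → Runs indexStepF
        (encodePair p ∙ encodeList encodePair (filterᵇ (E u) (pairs k₁ k₂)) ∙ encodeℕ (position (λ u → E u p) us))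
        (encodeℕ (position (λ u → E u p) (u ∷ us))) (K + cElem at M)
      indexStep u us = go u _ (E u p)
        (result (cong encodeBool (any-filter-pairs (E u) p)) (elem-runs k₁≤M k₂≤M p (filterᵇ (E u) (pairs k₁ k₂)) (length-edges u)))

    private
      encodeQuad : (Fin k₁ × Fin k₁) × (Fin k₂ × Fin k₂) → Value
      encodeQuad (p , q) = encodePair p ∙ encodePair q

      images : List ((Fin k₁ × Fin k₁) × (Fin k₂ × Fin k₂)) → List (Fin k × Fin k)
      images = representatives _==_ (pairStep part)

    insert-runs : ∀ xs {L} → length xs ≤ L →
      Runs insertF (encodedEdges ∙ nil ∙ encodeList encodeQuad xs)
        (encodeList encodePair (images xs)) (K + L * (K + cInsertStep at M))
    insert-runs xs len = foldAll-runs refl encodeQuad (λ xs → encodeList encodePair (images xs))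
      (λ x xs → insertStep x xs) xs len
      where
      go : ∀ x acc b → Runs elemF (encodePair (pairStep part x) ∙ nil ∙ encodeList encodePair acc)
          (encodeBool b) (cElem at M) →
        Runs insertStepF (encodedEdges ∙ encodeQuad x ∙ encodeList encodePair acc)
          (encodeList encodePair (if b then acc else pairStep part x ∷ acc)) (cInsertStep at M)
      go ((v , v′) , (w , w′)) acc false r = by-wp
        (index-runs (v , w) ▸ index-runs (v′ , w′) ▸ r ▸ refl , ticks ≤-refl)
      go ((v , v′) , (w , w′)) acc true r = by-wp
        (index-runs (v , w) ▸ index-runs (v′ , w′) ▸ r ▸ refl , ticks ≤-refl)
      insertStep : ∀ x xs → Runs insertStepF (encodedEdges ∙ encodeQuad x ∙ encodeList encodePair (images xs))
        (encodeList encodePair (images (x ∷ xs))) (cInsertStep at M)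
      insertStep x xs = go x (images xs) (any (pairStep part x ==_) (images xs))
        (elem-runs k≤M k≤M (pairStep part x) (images xs)
          (≤-trans (distinct-pairs-≤ (representatives-distinct _==_ (pairStep part) xs)) (*-mono-≤ k≤M k≤M)))

  module _ {s : Tree n} (leaves≤M : leaves s ≤ M) (α β : Asg s) where

    length-reach-≤ : ∀ {k} → k ≤ M → {t : Tree n} (d : Diagram t k) → length (reach α β d) ≤ cReachLength at M
    length-reach-≤ k≤M d = ≤-trans (length-reach α β d) (+-monoʳ-≤ 2 (*-mono-≤ k≤M k≤M))

    reach-nodes : ∀ {k} {t : Tree n} (d : Diagram t k) → diagramSize d ≤ M →
      Runs reachF (encodeAsg α ∙ encodeAsg β ∙ encodeDiagram d) (encodeList encodePair (reach α β d))
        (nodes t * cNode at M)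
    reach-nodes (leaf {x} lit cond) size≤M = weaken
      (≤-trans (m≤m+n _ ((cCross ⊕ cInsert) at M)) (≤-reflexive (sym (*-identityˡ _))))
      (by-wp
        ( leafPair-runs leaves≤M α β size≤M cond x false
        ▸ leafPair-runs leaves≤M α β size≤M cond x true
        ▸ refl , ticks {b = (cLeafPair ⊕ cLeafPair) at M} ≤-refl))
    reach-nodes {k} (node {t₁} {t₂} {k₁} {k₂} d₁ d₂ E part) size≤M = by-wp
      ( reach-nodes d₂ size₂≤M
      ▸ reach-nodes d₁ size₁≤M
      ▸ cross-runs encodePair encodePair (reach α β d₁) (reach α β d₂)
          (length-reach-≤ k₁≤M d₁) (length-reach-≤ k₂≤M d₂)
      ▸ insert-runs (≤-trans (width≤size (node d₁ d₂ E part)) size≤M) k₁≤M k₂≤M part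
          (cartesianProduct (reach α β d₁) (reach α β d₂)) length-cross
      ▸ refl , within bound)
      where
      size₁₂≤M : diagramSize d₁ + diagramSize d₂ ≤ M
      size₁₂≤M = ≤-trans (m≤n+m _ k) size≤M
      size₁≤M : diagramSize d₁ ≤ M
      size₁≤M = ≤-trans (m≤m+n _ _) size₁₂≤M
      size₂≤M : diagramSize d₂ ≤ M
      size₂≤M = ≤-trans (m≤n+m _ (diagramSize d₁)) size₁₂≤M
      k₁≤M : k₁ ≤ M
      k₁≤M = ≤-trans (width≤size d₁) size₁≤M
      k₂≤M : k₂ ≤ M
      k₂≤M = ≤-trans (width≤size d₂) size₂≤M
      length-cross : length (cartesianProduct (reach α β d₁) (reach α β d₂)) ≤ (cReachLength ⊗ cReachLength) at M
      length-cross = ≤-trans (≤-reflexive (length-cartesianProduct (reach α β d₁) (reach α β d₂)))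
        (*-mono-≤ (length-reach-≤ k₁≤M d₁) (length-reach-≤ k₂≤M d₂))
      open ≤-Reasoning
      N C I R₁ R₂ : ℕ
      N = cNode at M
      C = cCross at M
      I = cInsert at M
      R₁ = nodes t₁ * N
      R₂ = nodes t₂ * N
      P : ℕ
      P = (cLeafPair ⊕ cLeafPair) at M
      bound : 33 + (R₂ + R₁ + C + I) ≤ N + (nodes t₁ + nodes t₂) * N
      bound = begin
        33 + (R₂ + R₁ + C + I)             ≤⟨ Within.total-≤ (ticks {k = 33} ≤-refl) ⟩
        K + (R₂ + R₁ + C + I)              ≤⟨ m≤n+m _ P ⟩
        P + (K + (R₂ + R₁ + C + I))        ≡⟨ solve 6 (λ P K R₂ R₁ C I →
                                                P :+ (K :+ (R₂ :+ R₁ :+ C :+ I)) :=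
                                                K :+ P :+ (C :+ I) :+ (R₁ :+ R₂)) refl P K R₂ R₁ C I ⟩
        N + (R₁ + R₂)                      ≡⟨ cong (N +_) (*-distribʳ-+ N (nodes t₁) (nodes t₂)) ⟨
        N + (nodes t₁ + nodes t₂) * N      ∎

    reach-runs : ∀ {k} {t : Tree n} (d : Diagram t k) → diagramSize d ≤ M →
      Runs reachF (encodeAsg α ∙ encodeAsg β ∙ encodeDiagram d) (encodeList encodePair (reach α β d))
        (((𝕏 ⊕ 𝕏) ⊗ cNode) at M)
    reach-runs {t = t} d size≤M = weaken
      (*-monoˡ-≤ (cNode at M) (≤-trans (nodes≤2*leaves t)
        (+-mono-≤ (≤-trans (leaves≤size d) size≤M) (≤-trans (leaves≤size d) size≤M))))
      (reach-nodes d size≤M)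

    equivalent-runs : ∀ {k} {t : Tree n} (d : Diagram t k) → diagramSize d ≤ M → ∀ o →
      Runs equivalentF ((encodeDiagram d ∙ encodeFin o) ∙ encodeAsg α ∙ encodeAsg β)
        (encodeBool (equivalent α β d o)) (cEquivalent at M)
    equivalent-runs d size≤M o = by-wp
      ( reach-runs d size≤M
      ▸ foldAll-runs refl encodePair (λ ps → encodeBool (all (agree α β o) ps))
          (λ p ps → agreeStep p (all (agree α β o) ps)) (reach α β d) (length-reach-≤ k≤M d)
      ▸ refl , ticks ≤-refl)
      where
      k≤M = ≤-trans (width≤size d) size≤M
      go : ∀ u u′ acc b → Runs equalF (encodeBool (does (u ≟ o)) ∙ encodeBool (does (u′ ≟ o))) (encodeBool b) (cEq at M) →
        Runs agreeStepF (encodeFin o ∙ encodePair (u , u′) ∙ encodeBool acc) (encodeBool (b ∧ acc))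
          (K + (cEq ⊕ cEq ⊕ cEq) at M)
      go u u′ acc false r = by-wp (equal-Fin k≤M u o ▸ equal-Fin k≤M u′ o ▸ r ▸ refl , ticks ≤-refl)
      go u u′ acc true  r = by-wp (equal-Fin k≤M u o ▸ equal-Fin k≤M u′ o ▸ r ▸ refl , ticks ≤-refl)
      agreeStep : ∀ p acc → Runs agreeStepF (encodeFin o ∙ encodePair p ∙ encodeBool acc)
        (encodeBool (agree α β o p ∧ acc)) (K + (cEq ⊕ cEq ⊕ cEq) at M)
      agreeStep (u , u′) acc = go u u′ acc _ (equal-Bool (does (u ≟ o)) (does (u′ ≟ o)))

-- Running time of the construction

encodeList-allFin : ∀ {k} (g : Fin (suc k) → Value) →
  encodeList g (allFin (suc k)) ≡ g zero ∙ encodeList (g ∘ suc) (allFin k)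
encodeList-allFin {k} g = cong (λ vs → g zero ∙ foldr _∙_ nil vs)
  (trans (map-tabulate suc g) (sym (map-tabulate id (g ∘ suc))))

encodeList-cong : ∀ {k} {g h : Fin k → Value} → (∀ u → g u ≡ h u) →
  encodeList g (allFin k) ≡ encodeList h (allFin k)
encodeList-cong {k} {g} {h} g≗h = cong (foldr _∙_ nil)
  (trans (map-tabulate id g) (trans (tabulate-cong g≗h) (sym (map-tabulate id h))))

number-from-runs : ∀ {A : Set} (enc : A → Value) i xs →
  Runs numberF (encodeℕ i ∙ encodeList enc xs)
    (encodeList (λ u → encodeℕ (toℕ u + i) ∙ enc (lookup xs u)) (allFin (length xs)))
    (K + length xs * K)
number-from-runs enc i [] = by-wp (refl , ticks z≤n)
number-from-runs enc i (x ∷ xs) = result (sym numbering)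
  (by-wp (number-from-runs enc (suc i) xs ▸ refl , ticks ≤-refl))
  where
  numbering : encodeList (λ u → encodeℕ (toℕ u + i) ∙ enc (lookup (x ∷ xs) u)) (allFin (suc (length xs))) ≡
    (encodeℕ i ∙ enc x) ∙ encodeList (λ u → encodeℕ (toℕ u + suc i) ∙ enc (lookup xs u)) (allFin (length xs))
  numbering = trans (encodeList-allFin {length xs} (λ u → encodeℕ (toℕ u + i) ∙ enc (lookup (x ∷ xs) u)))
    (cong ((encodeℕ i ∙ enc x) ∙_)
      (encodeList-cong λ u → cong (λ j → encodeℕ j ∙ enc (lookup xs u)) (sym (+-suc (toℕ u) i))))

number-runs : ∀ {A : Set} (enc : A → Value) xs →
  Runs numberF (nil ∙ encodeList enc xs)
    (encodeList (λ u → encodeFin u ∙ enc (lookup xs u)) (allFin (length xs))) (K + length xs * K)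
number-runs enc xs = result
  (encodeList-cong λ u → cong (λ j → encodeℕ j ∙ enc (lookup xs u)) (+-identityʳ (toℕ u)))
  (number-from-runs enc 0 xs)

filterᵇ-∷ : ∀ {A : Set} (f : A → Bool) x xs →
  filterᵇ f (x ∷ xs) ≡ (if f x then x ∷ filterᵇ f xs else filterᵇ f xs)
filterᵇ-∷ f x xs with f x
... | true  = refl
... | false = refl

-- No loop is empty, so each overhead `K` standing outside a loop can be charged to its iterations.
-- Only the product of the iteration counts remains as a factor.
nested-loops : ∀ L L′ X → 1 ≤ L → 1 ≤ L′ →
  K + L * (K + (K + (K + L′ * X))) ≤ L * L′ * (K + (K + (K + (K + X))))
nested-loops L L′ X 1≤L 1≤L′ = begin
  K + L * (K + (K + (K + L′ * X)))          ≤⟨ absorb L _ 1≤L ⟩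
  L * (K + (K + (K + (K + L′ * X))))        ≤⟨ *-monoʳ-≤ L inner ⟩
  L * (L′ * (K + (K + (K + (K + X)))))      ≡⟨ *-assoc L L′ _ ⟨
  L * L′ * (K + (K + (K + (K + X))))        ∎
  where
  open ≤-Reasoning
  absorb : ∀ L X → 1 ≤ L → K + L * X ≤ L * (K + X)
  absorb (suc L) X _ = begin
    K + suc L * X             ≤⟨ +-monoˡ-≤ (suc L * X) (m≤n*m K (suc L)) ⟩
    suc L * K + suc L * X     ≡⟨ *-distribˡ-+ (suc L) K X ⟨
    suc L * (K + X)           ∎
  deeper : ∀ {A} X → A ≤ L′ * X → K + A ≤ L′ * (K + X)
  deeper X A≤ = ≤-trans (+-monoʳ-≤ K A≤) (absorb L′ X 1≤L′)
  inner : K + (K + (K + (K + L′ * X))) ≤ L′ * (K + (K + (K + (K + X))))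
  inner = deeper _ (deeper _ (deeper _ (deeper X ≤-refl)))

cubes : ∀ k a b → k * (a * b) + (a ^ 3 + b ^ 3) ≤ (k + (a + b)) ^ 3
cubes k a b = ≤-trans (m≤m+n _ rest) (≤-reflexive (solve 3 (λ k a b →
  k :* (a :* b) :+ (a :^ 3 :+ b :^ 3) :+
  (k :^ 3 :+ con 3 :* k :* (k :* (a :+ b) :+ (a :^ 2 :+ b :^ 2)) :+ con 5 :* k :* a :* b :+ con 3 :* a :* b :* (a :+ b))
  := (k :+ (a :+ b)) :^ 3) refl k a b))
  where
  -- The other monomials of the cube; of the six copies of `k * a * b` one is already spent.
  rest = k ^ 3 + 3 * k * (k * (a + b) + (a ^ 2 + b ^ 2)) + 5 * k * a * b + 3 * a * b * (a + b)

cLoops : Poly → Poly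
cLoops p = pK ⊕ (pK ⊕ (pK ⊕ (pK ⊕ p)))

cBuild : Poly
cBuild = pK ⊕ (cLoops (pK ⊕ pK) ⊕ cLoops (pK ⊕ (pK ⊕ cEquivalent)) ⊕ (pK ⊕ pK) ⊕ cLoops (pK ⊕ (pK ⊕ cEquivalent)))

-- Besides the children's shares there are the body itself, the cross product, the choice of
-- representatives, the numbering and the rows. As all widths are positive, each is at most
-- `k * (k₁ * k₂)` times a polynomial in the size of the given diagram.
build-bound : ∀ E k k₁ k₂ W₁ W₂ → 1 ≤ k → 1 ≤ k₁ → 1 ≤ k₂ →
  let loops = λ X → K + (K + (K + (K + X)))
      Q     = K + (loops (K + K) + loops (K + (K + E)) + (K + K) + loops (K + (K + E)))
  in K + (W₁ * Q + W₂ * Q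
       + (K + k₁ * (K + (K + (K + k₂ * (K + K)))))
       + (K + k₁ * k₂ * (K + (K + (K + k * (K + (K + E))))))
       + (K + k * K)
       + (K + k * (K + (K + (K + k₁ * k₂ * (K + (K + E)))))))
     ≤ (k * (k₁ * k₂) + (W₁ + W₂)) * Q
build-bound E k k₁ k₂ W₁ W₂ 1≤k 1≤k₁ 1≤k₂ = begin
  K + (W₁ * Q + W₂ * Q + crossing + classing + numbering + rowing)
    ≤⟨ +-mono-≤ (m≤n*m K w {{>-nonZero 1≤w}}) (+-mono-≤ (+-mono-≤ (+-mono-≤ (+-monoʳ-≤ (W₁ * Q + W₂ * Q)
         crossing≤) classing≤) numbering≤) rowing≤) ⟩
  w * K + (W₁ * Q + W₂ * Q + w * A + w * B + w * (K + K) + w * B)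
    ≡⟨ solve 6 (λ w K A B W₁ W₂ → let Q = K :+ (A :+ B :+ (K :+ K) :+ B) in
         w :* K :+ (W₁ :* Q :+ W₂ :* Q :+ w :* A :+ w :* B :+ w :* (K :+ K) :+ w :* B)
         := (w :+ (W₁ :+ W₂)) :* Q) refl w K A B W₁ W₂ ⟩
  (w + (W₁ + W₂)) * Q ∎
  where
  open ≤-Reasoning
  w A B Q crossing classing numbering rowing : ℕ
  w         = k * (k₁ * k₂)
  A         = K + (K + (K + (K + (K + K))))
  B         = K + (K + (K + (K + (K + (K + E)))))
  Q         = K + (A + B + (K + K) + B)
  crossing  = K + k₁ * (K + (K + (K + k₂ * (K + K))))
  classing  = K + k₁ * k₂ * (K + (K + (K + k * (K + (K + E)))))
  numbering = K + k * K
  rowing    = K + k * (K + (K + (K + k₁ * k₂ * (K + (K + E)))))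
  1≤k₁k₂ : 1 ≤ k₁ * k₂
  1≤k₁k₂ = *-mono-≤ 1≤k₁ 1≤k₂
  1≤w : 1 ≤ w
  1≤w = *-mono-≤ 1≤k 1≤k₁k₂
  crossing≤ : crossing ≤ w * A
  crossing≤ = ≤-trans (nested-loops k₁ k₂ _ 1≤k₁ 1≤k₂) (*-monoˡ-≤ A (m≤n*m (k₁ * k₂) k {{>-nonZero 1≤k}}))
  classing≤ : classing ≤ w * B
  classing≤ = ≤-trans (nested-loops (k₁ * k₂) k _ 1≤k₁k₂ 1≤k) (≤-reflexive (cong (_* B) (*-comm (k₁ * k₂) k)))
  numbering≤ : numbering ≤ w * (K + K)
  numbering≤ = begin
    K + k * K       ≤⟨ +-mono-≤ (m≤n*m K w {{>-nonZero 1≤w}})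
                         (*-monoˡ-≤ K (m≤m*n k (k₁ * k₂) {{>-nonZero 1≤k₁k₂}})) ⟩
    w * K + w * K   ≡⟨ *-distribˡ-+ w K K ⟨
    w * (K + K)     ∎
  rowing≤ : rowing ≤ w * B
  rowing≤ = nested-loops k (k₁ * k₂) _ 1≤k 1≤k₁k₂

module Build {n k} {s : Tree n} (d : Diagram s k) (o : Fin k) (dist-s : Distinct s)
  (n≤M : n ≤ diagramSize d) (1≤M : 1 ≤ diagramSize d) where

  private
    M = diagramSize d

  open Bounded M n≤M 1≤M

  accepts-cong : ∀ {γ γ′} → (∀ x → γ x ≡ γ′ x) → accepts d o γ ≡ accepts d o γ′
  accepts-cong eq = cong (λ u → does (u ≟ o)) (run-cong d (λ {x} _ → eq x))

  infix 4 _~_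
  _~_ : ∀ {t : Tree n} → Asg t → Asg t → Bool
  α ~ β = equivalent α β d o

  ~⇔ : ∀ {t : Tree n} (α β : Asg t) →
    T (α ~ β) ⇔ (∀ γ → accepts d o (α ▷ γ) ≡ accepts d o (β ▷ γ))
  ~⇔ α β = equivalent⇔ α β dist-s d o

  open Factors (accepts d o) accepts-cong _~_ ~⇔ public

  context : Value
  context = encodeDiagram d ∙ encodeFin o

  ~-runs : ∀ {t : Tree n} → leaves t ≤ M → (α β : Asg t) →
    Runs equivalentF (context ∙ encodeAsg α ∙ encodeAsg β) (encodeBool (α ~ β)) (cEquivalent at M)
  ~-runs small α β = equivalent-runs small α β d ≤-refl o

  known-runs : ∀ {t : Tree n} → leaves t ≤ M → ∀ (α : Asg t) βs {L} → length βs ≤ L →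
    Runs knownF ((context ∙ encodeAsg α) ∙ nil ∙ encodeList encodeAsg βs) (encodeBool (any (α ~_) βs))
      (K + L * (K + (K + cEquivalent at M)))
  known-runs small α = foldAll-runs refl encodeAsg (λ βs → encodeBool (any (α ~_) βs))
    (λ β βs → go β (any (α ~_) βs) (α ~ β) (~-runs small α β))
    where
    go : ∀ β acc b → Runs equivalentF (context ∙ encodeAsg α ∙ encodeAsg β) (encodeBool b) (cEquivalent at M) →
      Runs knownStepF ((context ∙ encodeAsg α) ∙ encodeAsg β ∙ encodeBool acc) (encodeBool (b ∨ acc))
        (K + cEquivalent at M)
    go β acc false r = by-wp (r ▸ refl , ticks ≤-refl)
    go β acc true  r = by-wp (r ▸ refl , ticks ≤-refl)

  encodeRep : (t : Tree n) → Fin (width t) → Value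
  encodeRep t u = encodeFin u ∙ encodeAsg (rep t u)

  -- The part of the running time that depends on the result; what it is multiplied by depends on
  -- the given diagram only.
  work : Tree n → ℕ
  work (leaf x)     = width (leaf x)
  work (node t₁ t₂) = width (node t₁ t₂) * (width t₁ * width t₂) + (work t₁ + work t₂)

  work≤size³ : ∀ t (dist : Distinct t) → work t ≤ diagramSize (diagram t dist) ^ 3
  work≤size³ (leaf x) dist = begin
    k′        ≡⟨ *-identityʳ k′ ⟨
    k′ ^ 1    ≤⟨ ^-monoʳ-≤ k′ {{width-nonZero {leaf x} dist}} {1} {3} (s≤s z≤n) ⟩
    k′ ^ 3    ∎
    where
    open ≤-Reasoning
    k′ = width (leaf x)
  work≤size³ (node t₁ t₂) dist@(_ , dist₁ , dist₂) = begin
    k′ * (width t₁ * width t₂) + (work t₁ + work t₂)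
      ≤⟨ +-mono-≤ (*-monoʳ-≤ k′ (*-mono-≤ (width≤size d₁) (width≤size d₂)))
           (+-mono-≤ (work≤size³ t₁ dist₁) (work≤size³ t₂ dist₂)) ⟩
    k′ * (diagramSize d₁ * diagramSize d₂) + (diagramSize d₁ ^ 3 + diagramSize d₂ ^ 3)
      ≤⟨ cubes k′ (diagramSize d₁) (diagramSize d₂) ⟩
    (k′ + (diagramSize d₁ + diagramSize d₂)) ^ 3 ∎
    where
    open ≤-Reasoning
    k′ = width (node t₁ t₂)
    d₁ = diagram t₁ dist₁
    d₂ = diagram t₂ dist₂

  module _ {t₁ t₂ : Tree n} (small : leaves (node t₁ t₂) ≤ M) where

    private
      k′ = width (node t₁ t₂)
      k₁ = width t₁
      k₂ = width t₂

      joins : Fin k₁ × Fin k₂ → Asg (node t₁ t₂)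
      joins = join (classes t₁) (classes t₂)

      encodeCandidate : Fin k₁ × Fin k₂ → Value
      encodeCandidate (v , w) = encodeRep t₁ v ∙ encodeRep t₂ w

    classes-runs : Runs classesF (context ∙ nil ∙ encodeList encodeCandidate (pairs k₁ k₂))
      (encodeList encodeAsg (classes (node t₁ t₂)))
      (K + k₁ * k₂ * (K + (K + (K + k′ * (K + (K + cEquivalent at M))))))
    classes-runs = fold-runs refl encodeCandidate (λ ps → encodeList encodeAsg (representatives _~_ joins ps))
      -- The invariant on suffixes: the representatives found so far are never more than the final
      -- `k′`, so each candidate meets at most `k′` equivalence tests.
      (λ ps → length (representatives _~_ joins ps) ≤ k′)
      (λ p ps len → let len′ = ≤-trans (length-representatives-∷ _~_ joins p ps) len in len′ , classStep p ps len′)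
      (pairs k₁ k₂) ≤-refl (≤-reflexive (length-pairs k₁ k₂))
      where
      C : ℕ
      C = K + k′ * (K + (K + cEquivalent at M))
      go : ∀ p acc b → Runs knownF ((context ∙ encodeAsg (joins p)) ∙ nil ∙ encodeList encodeAsg acc) (encodeBool b) C →
        Runs classStepF (context ∙ encodeCandidate p ∙ encodeList encodeAsg acc)
          (encodeList encodeAsg (if b then acc else joins p ∷ acc)) (K + C)
      go p acc false r = by-wp (r ▸ refl , ticks ≤-refl)
      go p acc true  r = by-wp (r ▸ refl , ticks ≤-refl)
      classStep : ∀ p ps → length (representatives _~_ joins ps) ≤ k′ →
        Runs classStepF (context ∙ encodeCandidate p ∙ encodeList encodeAsg (representatives _~_ joins ps))
          (encodeList encodeAsg (representatives _~_ joins (p ∷ ps))) (K + C)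
      classStep p ps len = go p (representatives _~_ joins ps) (any (joins p ~_) (representatives _~_ joins ps))
        (known-runs small (joins p) (representatives _~_ joins ps) len)

    row-runs : ∀ u → Runs rowF
      ((context ∙ encodeAsg (rep (node t₁ t₂) u)) ∙ nil ∙ encodeList encodeCandidate (pairs k₁ k₂))
      (encodeList encodePair (filterᵇ (edges t₁ t₂ u) (pairs k₁ k₂)))
      (K + k₁ * k₂ * (K + (K + cEquivalent at M)))
    row-runs u = foldAll-runs refl encodeCandidate
      (λ ps → encodeList encodePair (filterᵇ (edges t₁ t₂ u) ps))
      (λ p ps → result (cong (encodeList encodePair) (sym (filterᵇ-∷ (edges t₁ t₂ u) p ps)))
        (go p _ (edges t₁ t₂ u p) (~-runs small (rep (node t₁ t₂) u) (joins p))))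
      (pairs k₁ k₂) (≤-reflexive (length-pairs k₁ k₂))
      where
      go : ∀ p acc b →
        Runs equivalentF (context ∙ encodeAsg (rep (node t₁ t₂) u) ∙ encodeAsg (joins p)) (encodeBool b) (cEquivalent at M) →
        Runs rowStepF ((context ∙ encodeAsg (rep (node t₁ t₂) u)) ∙ encodeCandidate p ∙ encodeList encodePair acc)
          (encodeList encodePair (if b then p ∷ acc else acc)) (K + cEquivalent at M)
      go p acc false r = by-wp (r ▸ refl , ticks ≤-refl)
      go p acc true  r = by-wp (r ▸ refl , ticks ≤-refl)

    rows-runs : Runs rowsF
      ((context ∙ encodeList encodeCandidate (pairs k₁ k₂)) ∙ nil ∙ encodeList (encodeRep (node t₁ t₂)) (allFin k′))
      (encodeList (λ u → encodeList encodePair (filterᵇ (edges t₁ t₂ u) (pairs k₁ k₂))) (allFin k′))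
      (K + k′ * (K + (K + (K + k₁ * k₂ * (K + (K + cEquivalent at M))))))
    rows-runs = foldAll-runs refl (encodeRep (node t₁ t₂))
      (λ us → encodeList (λ u → encodeList encodePair (filterᵇ (edges t₁ t₂ u) (pairs k₁ k₂))) us)
      (λ u us → by-wp (row-runs u ▸ refl , ticks ≤-refl))
      (allFin k′) (≤-reflexive (length-allFin k′))

  leaf-runs : ∀ {x} → leaves (leaf x) ≤ M → ∀ b →
    Runs equivalentF (context ∙ encodeAsg (leaf {x = x} false) ∙ encodeAsg (leaf {x = x} true)) (encodeBool b)
      (cEquivalent at M) →
    Runs buildF (context ∙ encodeTree (leaf x))
      (encodeList (λ u → encodeFin u ∙ encodeAsg (lookup (leafClasses {x} b) u)) (allFin (length (leafClasses {x} b))) ∙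
        nil ∙ encodeFin x ∙ encodeList (λ u → encodeLiteral (leafLiteral {x} b u)) (allFin (length (leafClasses {x} b))))
      (K + cEquivalent at M)
  leaf-runs small false r = by-wp (r ▸ refl , ticks ≤-refl)
  leaf-runs small true  r = by-wp (r ▸ refl , ticks ≤-refl)

  1≤width : ∀ {t} → Distinct t → 1 ≤ width t
  1≤width {t} dist = nonZero⇒≥1 (width t) {{width-nonZero dist}}

  build-runs : ∀ t (dist : Distinct t) → leaves t ≤ M →
    Runs buildF (context ∙ encodeTree t)
      (encodeList (encodeRep t) (allFin (width t)) ∙ encodeDiagram (diagram t dist))
      (work t * cBuild at M)
  build-runs (leaf x) dist small = weaken bound
    (leaf-runs small (irrelevant x) (~-runs small (leaf {x = x} false) (leaf true)))
    where
    open ≤-Reasoning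
    K+ : ∀ {i j} → i ≤ j → i ≤ K + j
    K+ i≤j = ≤-trans i≤j (m≤n+m _ K)
    bound : K + cEquivalent at M ≤ width (leaf x) * cBuild at M
    bound = begin
      K + cEquivalent at M      ≤⟨ +-monoʳ-≤ K (≤-trans (K+ (K+ (K+ (K+ (K+ (K+ ≤-refl)))))) (m≤n+m _
        ((cLoops (pK ⊕ pK) ⊕ cLoops (pK ⊕ (pK ⊕ cEquivalent)) ⊕ (pK ⊕ pK)) at M))) ⟩
      cBuild at M               ≤⟨ m≤n*m (cBuild at M) (width (leaf x)) {{width-nonZero {leaf x} dist}} ⟩
      width (leaf x) * cBuild at M ∎
  build-runs (node t₁ t₂) dist@(_ , dist₁ , dist₂) small = by-wp
    ( build-runs t₁ dist₁ (≤-trans (m≤m+n _ _) small)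
    ▸ build-runs t₂ dist₂ (≤-trans (m≤n+m _ (leaves t₁)) small)
    ▸ cross-runs (encodeRep t₁) (encodeRep t₂) (allFin (width t₁)) (allFin (width t₂))
        (≤-reflexive (length-allFin (width t₁))) (≤-reflexive (length-allFin (width t₂)))
    ▸ classes-runs {t₁} {t₂} small
    ▸ number-runs encodeAsg (classes (node t₁ t₂))
    ▸ rows-runs {t₁} {t₂} small
    ▸ refl , within (≤-trans (Within.total-≤ (ticks {k = 57} ≤-refl))
        (build-bound (cEquivalent at M) (width (node t₁ t₂)) (width t₁) (width t₂) (work t₁) (work t₂)
          (1≤width dist) (1≤width dist₁) (1≤width dist₂))))

-- The conversion and its total cost

2≤width : ∀ {n} {V : VTree n} (D : BooleanTDD V) → 2 ≤ TDD.width D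
2≤width D = two (TDD.output D) (proj₁ (TDD.bijective D))
  where
  two : ∀ {k} (out : Bool → Fin k) → (∀ {b c} → out b ≡ out c → b ≡ c) → 2 ≤ k
  two {suc (suc k)} out injective = s≤s (s≤s z≤n)
  two {suc zero} out injective with out false in eq | out true in eq′
  ... | zero | zero = contradiction (injective (trans eq (sym eq′))) λ ()
  two {zero} out injective with out true
  ... | ()

cTotal : Poly
cTotal = pK ⊕ (cBuild ⊕ (𝕏 ⊕ 𝕏) ⊗ cNode ⊕ cEq)

module Conversion {n} (V W : VTree n) (D : BooleanTDD V) where

  private
    d = TDD.diagram D
    o = TDD.output D true
    t = tree W
    M = TDD.size D

  2≤size : 2 ≤ M
  2≤size = ≤-trans (2≤width D) (width≤size d)

  open Bounded M (variables≤size V d) (≤-trans (n≤1+n 1) 2≤size)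
  open Build d o (vtree-distinct V) (variables≤size V d) (≤-trans (n≤1+n 1) 2≤size)
  open Roots (accepts d o) accepts-cong _~_ ~⇔ W
    using (value; value-▷; IsClassDiagram; classDiagram; withOutputs)

  small : leaves t ≤ M
  small = ≤-trans (leaves≤variables t (vtree-distinct W)) (variables≤size V d)

  accepts≡computes : ∀ a → accepts d o (Vec.lookup a) ≡ computes D a
  accepts≡computes a = T-injective (mk⇔
    (λ r → Equivalence.from (eval-run d o a) (sym (does⁻ (run d (Vec.lookup a) ≟ o) r)))
    (λ e → does⁺ (run d (Vec.lookup a) ≟ o) (sym (Equivalence.to (eval-run d o a) e))))

  input : Value
  input = encodeTDD (full D) ∙ encodeVTree W

  encodeReps : List (Asg t) → Value
  encodeReps αs = encodeList (λ u → encodeFin u ∙ encodeAsg (lookup αs u)) (allFin (length αs))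

  -- The head `α` represents root node 0, whose value fixes the labels; whether `αs` is empty only
  -- selects the form of the output.
  main-runs : ∀ α αs encoded {B} →
    Runs buildF (context ∙ encodeTree t) (encodeReps (α ∷ αs) ∙ encoded) B →
    ∃[ time ] (algorithm ⟨ input ⟩⇓ encodeRoots αs (value α) encoded / time) ×
      time ≤ K + (B + ((𝕏 ⊕ 𝕏) ⊗ cNode) at M + cEq at M)
  main-runs α αs encoded {B} built = go (reach α α d) refl (reach-runs small α α d ≤-refl)
    where
    bound : ℕ
    bound = K + (B + ((𝕏 ⊕ 𝕏) ⊗ cNode) at M + cEq at M)
    evaluated : ∀ b {u u′ ps} →
      Runs reachF (encodeAsg α ∙ encodeAsg α ∙ encodeDiagram d) (encodeList encodePair ((u , u′) ∷ ps))
        (((𝕏 ⊕ 𝕏) ⊗ cNode) at M) →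
      Runs equalF (encodeFin u ∙ encodeFin o) (encodeBool b) (cEq at M) → ∀ αs →
      Runs buildF (context ∙ encodeTree t) (encodeReps (α ∷ αs) ∙ encoded) B →
      ∃[ time ] (algorithm ⟨ input ⟩⇓ encodeRoots αs b encoded / time) × time ≤ bound
    evaluated false reached compared []      built =
      wp-run mainCode (built ▸ reached ▸ compared ▸ refl , ticks ≤-refl)
    evaluated true  reached compared []      built =
      wp-run mainCode (built ▸ reached ▸ compared ▸ refl , ticks ≤-refl)
    evaluated false reached compared (_ ∷ _) built =
      wp-run mainCode (built ▸ reached ▸ compared ▸ refl , ticks ≤-refl)
    evaluated true  reached compared (_ ∷ _) built =
      wp-run mainCode (built ▸ reached ▸ compared ▸ refl , ticks ≤-refl)
    go : ∀ ps → ps ≡ reach α α d →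
      Runs reachF (encodeAsg α ∙ encodeAsg α ∙ encodeDiagram d) (encodeList encodePair ps)
        (((𝕏 ⊕ 𝕏) ⊗ cNode) at M) →
      ∃[ time ] (algorithm ⟨ input ⟩⇓ encodeRoots αs (value α) encoded / time) × time ≤ bound
    go [] eq reached with subst ((run d (α ▷ λ _ → false) , run d (α ▷ λ _ → false)) ∈_) (sym eq) (reach-complete α α d _)
    ... | ()
    go ((u , u′) ∷ ps) eq reached with reach-sound α α (vtree-distinct V) d (subst ((u , u′) ∈_) eq (here refl))
    -- The head of the list belongs to an unknown completion `γ`, but `α` assigns every variable, so
    -- by `value-▷` the comparison yields `value α` all the same.
    ... | γ , refl = evaluated (value α) {ps = ps} reached
      (result (cong encodeBool (value-▷ α γ)) (equal-Fin (width≤size d) u o)) αs built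

  reduced : ∀ αs (dg : Diagram t (length αs)) → .{{NonZero (length αs)}} → IsClassDiagram αs dg → ∀ {B} →
    Runs buildF (context ∙ encodeTree t) (encodeReps αs ∙ encodeDiagram dg) B →
    Σ (BooleanTDD₁ W) λ D′ → Reduced D′ × D′ ≋ full D × size₁ D′ ≡ diagramSize dg ×
      ∃[ time ] (algorithm ⟨ input ⟩⇓ encodeTDD D′ / time) ×
        time ≤ K + (B + ((𝕏 ⊕ 𝕏) ⊗ cNode) at M + cEq at M)
  reduced (α ∷ αs) dg isClass built with withOutputs α αs dg isClass | main-runs α αs (encodeDiagram dg) built
  ... | D′ , red , correct , size≡ , encode≡ | time , derivation , time≤ =
    D′ , red , (λ a → trans (correct a) (accepts≡computes a)) , size≡ ,
    time , subst (λ v → algorithm ⟨ input ⟩⇓ v / time) (sym encode≡) derivation , time≤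

  total-bound : ∀ w s b r e → w ≤ s ^ 3 → 1 ≤ s → K + (w * b + r + e) ≤ s ^ 4 * (K + (b + r + e))
  total-bound w s b r e w≤ 1≤s = begin
    K + (w * b + r + e)                         ≤⟨ +-mono-≤ (up K) (+-mono-≤ (+-mono-≤ (*-monoˡ-≤ b w≤s⁴) (up r)) (up e)) ⟩
    S * K + (S * b + S * r + S * e)             ≡⟨ cong (λ x → S * K + (x + S * e)) (*-distribˡ-+ S b r) ⟨
    S * K + (S * (b + r) + S * e)               ≡⟨ cong (S * K +_) (*-distribˡ-+ S (b + r) e) ⟨
    S * K + S * (b + r + e)                     ≡⟨ *-distribˡ-+ S K (b + r + e) ⟨
    S * (K + (b + r + e))                       ∎
    where
    open ≤-Reasoning
    S : ℕ
    S = s ^ 4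
    up : ∀ x → x ≤ S * x
    up x = m≤n*m x S {{m^n≢0 s 4 {{>-nonZero 1≤s}}}}
    w≤s⁴ : w ≤ S
    -- The cubic bound on `work` leaves one factor to spare.
    w≤s⁴ = ≤-trans w≤ (^-monoʳ-≤ s {{>-nonZero 1≤s}} {3} {4} (s≤s (s≤s (s≤s z≤n))))

  private
    dist = vtree-distinct W

  conversion : Σ (BooleanTDD₁ W) λ D′ → Reduced D′ × D′ ≋ full D ×
    ∃[ time ] (algorithm ⟨ input ⟩⇓ encodeTDD D′ / time) × time ≤ size₁ D′ ^ 4 * cTotal at M
  conversion
    with D′ , red , equiv , size≡ , time , derivation , time≤ ←
      reduced (classes t) (diagram t dist) {{width-nonZero dist}} (classDiagram dist) (build-runs t dist small)
    = D′ , red , equiv , time , derivation , ≤-trans time≤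
        (subst (λ s → _ ≤ s ^ 4 * _) (sym size≡)
          (total-bound (work t) (diagramSize (diagram t dist)) _ _ _ (work≤size³ t dist)
            (≤-trans (1≤width dist) (width≤size (diagram t dist)))))

theorem13 : Σ Program λ algorithm → Σ ℕ λ c →
    ∀ {n : ℕ} (V W : VTree n) (D : BooleanTDD V) →
    Σ (BooleanTDD₁ W) λ D′ →
    Reduced D′ ×
    D′ ≋ full D ×
    ∃[ time ]
    (algorithm ⟨ encodeTDD (full D) ∙ encodeVTree W ⟩⇓ encodeTDD D′ / time) ×
    time ≤ size₁ D′ ^ 4 * TDD.size D ^ c
theorem13 = algorithm , proj₁ (poly-≤-power cTotal) , λ V W D →
  let D′ , red , equiv , time , derivation , time≤ = Conversion.conversion V W D
  in D′ , red , equiv , time , derivation , ≤-trans time≤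
       (*-monoʳ-≤ (size₁ D′ ^ 4) (proj₂ (poly-≤-power cTotal) (Conversion.2≤size V W D)))
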